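{- The approximation factor $1-1/e$ of the following greedy algorithm for MBC is tight: for every $\varepsilon>0$ there exists an instance of MBC with unit costs ($c\equiv 1$, budget $b=k$ a positive integer) on which some execution of the algorithm (i.e., for some choice among maximizers in the arg max steps) returns a set $H$ with $\operatorname{GBC}(H)\le (1-1/e+\varepsilon)\cdot\mathrm{OPT}$, where $\mathrm{OPT}$ is the optimum value of the instance. The algorithm: set $H:=\emptyset$. For each $C_0\subseteq V$ with $|C_0|\le 3$ and $c(C_0)\le b$: let $C:=C_0$ and $U:=V\setminus C_0$; while $U\neq\emptyset$, choose $u\in U$ maximizing $(\operatorname{GBC}(C\cup\{u\})-\operatorname{GBC}(C))/c(u)$, add $u$ to $C$ if $c(C\cup\{u\})\le b$, and remove $u$ from $U$; afterwards, if $\operatorname{GBC}(C)>\operatorname{GBC}(H)$ set $H:=C$. Return $H$.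
   Context: An instance of \textsc{Maximum Betweenness Centrality} (MBC) consists of an undirected connected graph $G=(V,E)$, node costs $c\colon V\to\mathbb{R}_{\ge 0}$ and a budget $b\ge 0$. For distinct $s,t\in V$ let $\sigma_{s,t}$ be the number of shortest $s$--$t$ paths, and for $C\subseteq V$ let $\sigma_{s,t}(C)$ be the number of shortest $s$--$t$ paths containing at least one node of $C$. The group betweenness centrality is $\operatorname{GBC}(C)=\sum_{s,t\in V,\ s\neq t}\sigma_{s,t}(C)/\sigma_{s,t}$. A set $C\subseteq V$ is feasible if $\sum_{v\in C}c(v)\le b$; the goal is to find a feasible $C$ maximizing $\operatorname{GBC}(C)$. This algorithm is known to always achieve $\operatorname{GBC}(H)\ge(1-1/e)\mathrm{OPT}$. -}

module Defs where

open import Data.Bool using (Bool; true; false; if_then_else_)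
open import Data.Nat as ℕ using (ℕ; zero; suc; _!)
open import Data.Nat.Properties using () renaming (_≤?_ to _≤ℕ?_)
open import Data.Integer using (+_)
open import Data.Fin using (Fin; _≟_)
open import Data.List using (List; []; _∷_; concatMap; map; length; foldr; any; filter)
open import Data.Vec using (Vec; lookup; _∷_; [])
open import Data.Fin.Subset using () renaming (_-_ to _∖_)
open import Data.Fin.Subset using (Subset; ⊥; ⁅_⁆; ∁; _∪_; ∣_∣; Empty; _∈_)
open import Data.Rational using (ℚ; 0ℚ; _+_; _-_; _*_; _/_; _<_; _≤_; -_)
open import Data.Product using (∃; _×_)
open import Relation.Nullary using (does)
open import Relation.Binary.PropositionalEquality using (_≡_; _≢_)

record Graph (n : ℕ) : Set where
  field
    adj   : Fin n → Fin n → Bool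
    sym   : ∀ u v → adj u v ≡ adj v u
    irrefl : ∀ v → adj v v ≡ false
open Graph public

module _ {n : ℕ} (G : Graph n) where

  walks : ℕ → Fin n → Fin n → List (List (Fin n))
  walks zero    s t = if does (s ≟ t) then (s ∷ []) ∷ [] else []
  walks (suc L) s t =
    concatMap (λ v → if adj G s v then map (s ∷_) (walks L v t) else [])
              (Data.List.allFin n)
    where import Data.List

  Connected : Set
  Connected = ∀ s t → ∃ λ L → walks L s t ≢ []

  -- distance: least L (searching L = 0,1,…,n) with a walk of length L;
  -- for a connected graph the distance is < n, so the search is exact.
  private
    search : ℕ → ℕ → Fin n → Fin n → ℕ
    search zero       L s t = L
    search (suc fuel) L s t with walks L s t
    ... | []    = search fuel (suc L) s t
    ... | _ ∷ _ = L

  dist : Fin n → Fin n → ℕ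
  dist s t = search n 0 s t

  -- shortest s–t paths (walks of minimal length are exactly the shortest paths)
  shortestPaths : Fin n → Fin n → List (List (Fin n))
  shortestPaths s t = walks (dist s t) s t

  σ : Fin n → Fin n → ℕ
  σ s t = length (shortestPaths s t)

  σ[_] : Subset n → Fin n → Fin n → ℕ
  σ[ C ] s t = length (filter (λ p → Data.List.Relation.Unary.Any.any?
                          (λ v → Data.Bool._≟_ (lookup C v) true) p)
                        (shortestPaths s t))
    where import Data.List.Relation.Unary.Any
          import Data.Bool

-- a / b as a rational (0 if b = 0; never used with b = 0 in connected graphs)
frac : ℕ → ℕ → ℚ
frac a zero    = 0ℚ
frac a (suc b) = (+ a) / suc b

sumℚ : List ℚ → ℚ
sumℚ = foldr _+_ 0ℚ

GBC : ∀ {n} → Graph n → Subset n → ℚ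
GBC {n} G C = sumℚ (map (λ s → sumℚ (map (λ t →
                 if does (s ≟ t) then 0ℚ else frac (σ[_] G C s t) (σ G s t))
               (Data.List.allFin n))) (Data.List.allFin n))
  where import Data.List

-- The greedy algorithm, specialised to unit costs c ≡ 1 and budget b = k.
-- Executions are described relationally; every choice among maximizers
-- in the arg max step is allowed.

module _ {n : ℕ} (G : Graph n) (k : ℕ) where

  -- marginal gain (GBC(C ∪ {u}) − GBC(C)) / c(u) with c(u) = 1
  gain : Subset n → Fin n → ℚ
  gain C u = GBC G (C ∪ ⁅ u ⁆) - GBC G C

  data GreedyLoop : Subset n → Subset n → Subset n → Set where
    done : ∀ {C U} → Empty U → GreedyLoop C U C
    step : ∀ {C U C'} (u : Fin n) → u ∈ U →
           (∀ v → v ∈ U → gain C v ≤ gain C u) →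
           GreedyLoop (if does (∣ C ∪ ⁅ u ⁆ ∣ ≤ℕ? k) then C ∪ ⁅ u ⁆ else C) (U ∖ u) C' →
           GreedyLoop C U C'

  data OuterLoop : Subset n → List (Subset n) → Subset n → Set where
    finish : ∀ {H} → OuterLoop H [] H
    skip   : ∀ {H C₀ Cs H'} →
             (does (∣ C₀ ∣ ℕ.≤? 3) Data.Bool.∧ does (∣ C₀ ∣ ℕ.≤? k)) ≡ false →
             OuterLoop H Cs H' → OuterLoop H (C₀ ∷ Cs) H'
    visit  : ∀ {H C₀ Cs C H'} →
             ∣ C₀ ∣ ℕ.≤ 3 → ∣ C₀ ∣ ℕ.≤ k →
             GreedyLoop C₀ (∁ C₀) C →
             OuterLoop (if does (GBC G H Data.Rational.<? GBC G C) then C else H) Cs H' →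
             OuterLoop H (C₀ ∷ Cs) H'

allSubsets : ∀ n → List (Subset n)
allSubsets zero    = [] ∷ []
allSubsets (suc n) = concatMap (λ p → (true ∷ p) ∷ (false ∷ p) ∷ []) (allSubsets n)

GreedyOutput : ∀ {n} → Graph n → ℕ → Subset n → Set
GreedyOutput {n} G k H = OuterLoop G k ⊥ (allSubsets n) H

-- 1/e via its alternating series e⁻¹ = Σ (-1)^j / j!.  The even partial
-- sums  T m = Σ_{j=0}^{2m} (-1)^j / j!  decrease to 1/e, so T m > 1/e
-- and 1 - T m < 1 - 1/e, with 1 - T m → 1 - 1/e.

isEven : ℕ → Bool
isEven zero    = true
isEven (suc j) = if isEven j then false else true

invETerm : ℕ → ℚ
invETerm j = if isEven j then frac 1 (j !) else - frac 1 (j !)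

invEPartial : ℕ → ℚ
invEPartial zero    = invETerm zero
invEPartial (suc j) = invEPartial j + invETerm (suc j)

invEUpper : ℕ → ℚ
invEUpper m = invEPartial (2 ℕ.* m)

{-# OPTIONS --safe #-}

-- The tight example for greedy maximum coverage, realised by shortest paths.  The gadget has nodes
-- S i and O j, joined completely, a cloud X of pendants distributed over the S i (a i of them at S i)
-- and a cloud Y of pendants with b of them at each O j; each cloud is a clique.  A pendant x of S i
-- and a pendant y of O j have the single shortest path x, S i, O j, y, and the number of such pairs is
-- quadratic in the scale of a and b.  All other pairs contribute to GBC only when one endpoint is an
-- S, an O or a chosen node, which is of linear order.  So, up to noise, GBC counts the covered edges
-- of a weighted complete bipartite graph.
--
-- With k the budget and the number of O's, choosing all O's covers everything.  The weights a i shrink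
-- by the factor q/(q+1), k = q + 5, so that as long as at most three O's are chosen some S i covers more
-- new weight than any O j: the greedy loop never adds an O, whatever seed of size at most three it
-- starts from.  It leaves uncovered about (1 - 1/(q+1))^k of the total, which tends to 1/e.  The
-- comparison with the alternating series for 1/e expands (1 - 1/(q+1))^(q+1) binomially and truncates
-- by Bonferroni's inequality.

module Submission where

open import Defs hiding (sym)
open import Data.Nat using (ℕ) renaming (_≤_ to _≤ℕ_)
open import Data.Rational using (ℚ; 0ℚ; 1ℚ; _+_; _-_; _*_; _<_; _≤_)
open import Data.Fin.Subset using (Subset; ∣_∣)
open import Data.Product using (Σ; ∃; _×_)

open import Algebra.Bundles using (CommutativeMonoid)
open import Relation.Binary using (DecTotalOrder)
open import Data.Bool as Bool using (Bool; true; false; if_then_else_; not)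
open import Data.Nat as ℕ using (zero; suc; _!; s≤s; z≤n)
import Data.Nat.Properties as ℕₚ
import Data.Nat.Solver
open import Data.Integer as ℤ using (+<+)
import Data.Integer.Properties as ℤₚ
open import Data.Rational as ℚ using (mkℚ; _/_; -_; toℚᵘ; positive; nonNegative; *<*)
open import Data.Rational.Properties
open import Data.Rational.Solver using (module +-*-Solver)
open import Data.Rational.Unnormalised as ℚᵘ using (mkℚᵘ; *≡*)
import Data.Rational.Unnormalised.Properties as ℚᵘₚ
open import Data.Fin using (Fin; zero; suc; _↑ˡ_; _↑ʳ_; splitAt; fromℕ<) renaming (_≟_ to _≟F_)
import Data.Fin.Properties as Finₚ
open import Data.Fin.Properties using (splitAt-↑ˡ; splitAt-↑ʳ; splitAt⁻¹-↑ˡ; splitAt⁻¹-↑ʳ)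
open import Data.Fin.Subset using (_∪_; ⁅_⁆; ∁; _─_; ⊥; inside; outside) renaming (_∈_ to _∈ₛ_; _∉_ to _∉ₛ_; _-_ to _∖_)
open import Data.Fin.Subset.Properties using (nonempty?; x∈p∪q⁻; x∈p∪q⁺; x∈⁅x⁆; x∈⁅y⁆⇒x≡y; x∈p∧x≢y⇒x∈p-y; x∈p⇒∣p-x∣<∣p∣; p─q⊆p; x∈∁p⇒x∉p; x∉p⇒x∈∁p; ∣⊥∣≡0; _∈?_)
open import Data.Vec as Vec using ([]; _∷_; lookup; here; there)
open import Data.Vec.Properties using ([]=⇒lookup; lookup⇒[]=; lookup∘tabulate)
open import Data.List using (List; []; _∷_; map; length; allFin; filter; tabulate)
open import Data.List.Properties using (length-filter; filter-all; filter-none; map-tabulate)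
open import Data.List.Membership.Propositional using (_∈_; lose; find)
open import Data.List.Membership.Propositional.Properties using (∈-concatMap⁺; ∈-concatMap⁻; ∈-map⁺; ∈-map⁻; ∈-allFin; ∈-filter⁺)
open import Data.List.Relation.Unary.Any as Any using (Any; here; there)
import Data.List.Relation.Unary.All as All
open import Data.List.Relation.Unary.All.Properties using (all-filter)
open import Data.List.Extrema (DecTotalOrder.totalOrder ≤-decTotalOrder) using (argmax; argmax-all; f[xs]≤f[argmax])
open import Data.Product using (_,_; proj₁; proj₂)
open import Data.Sum using (inj₁; inj₂; [_,_])
open import Algebra.Properties.Semiring.Sum ℕₚ.+-*-semiring using (sum; sum-cong-≗; ∑-distrib-+; *-distribˡ-sum; *-distribʳ-sum)
open import Algebra.Properties.CommutativeSemigroup (CommutativeMonoid.commutativeSemigroup +-0-commutativeMonoid)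
  using (interchange)
open import Function using (_∘_; id; case_of_)
open import Relation.Nullary using (¬_; Dec; does; yes; no; contradiction)
open import Relation.Unary using (Decidable)
open import Relation.Binary.PropositionalEquality hiding (J; [_])

-- The embedding of ℕ into ℚ

opaque
  ι : ℕ → ℚ
  ι n = ℤ.+ n / 1

toℚᵘ-/ : ∀ a d → toℚᵘ (ℤ.+ a / suc d) ℚᵘ.≃ mkℚᵘ (ℤ.+ a) d
toℚᵘ-/ a d = toℚᵘ-fromℚᵘ (mkℚᵘ (ℤ.+ a) d)

opaque
  unfolding ι

  ι-+ : ∀ m n → ι (m ℕ.+ n) ≡ ι m + ι n
  ι-+ m n = toℚᵘ-injective (ℚᵘₚ.≃-trans (toℚᵘ-/ (m ℕ.+ n) 0) (ℚᵘₚ.≃-trans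
    (*≡* (cong (ℤ._* ℤ.+ 1) (cong₂ ℤ._+_ (sym (ℤₚ.*-identityʳ (ℤ.+ m))) (sym (ℤₚ.*-identityʳ (ℤ.+ n))))))
    (ℚᵘₚ.≃-sym (ℚᵘₚ.≃-trans (toℚᵘ-homo-+ (ι m) (ι n)) (ℚᵘₚ.+-cong (toℚᵘ-/ m 0) (toℚᵘ-/ n 0))))))

  ι-* : ∀ m n → ι (m ℕ.* n) ≡ ι m * ι n
  ι-* m n = toℚᵘ-injective (ℚᵘₚ.≃-trans (toℚᵘ-/ (m ℕ.* n) 0) (ℚᵘₚ.≃-trans
    (*≡* (cong (ℤ._* ℤ.+ 1) (ℤₚ.pos-* m n)))
    (ℚᵘₚ.≃-sym (ℚᵘₚ.≃-trans (toℚᵘ-homo-* (ι m) (ι n)) (ℚᵘₚ.*-cong (toℚᵘ-/ m 0) (toℚᵘ-/ n 0))))))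

  ι-0 : ι 0 ≡ 0ℚ
  ι-0 = refl

  ι-1 : ι 1 ≡ 1ℚ
  ι-1 = refl

  0≤ι : ∀ n → 0ℚ ≤ ι n
  0≤ι n = nonNegative⁻¹ (ι n) {{normalize-nonNeg n 1}}

  ι*frac : ∀ a b → ι (suc b) * frac a (suc b) ≡ ι a
  ι*frac a b = toℚᵘ-injective (ℚᵘₚ.≃-trans (toℚᵘ-homo-* (ι (suc b)) (frac a (suc b)))
    (ℚᵘₚ.≃-trans (ℚᵘₚ.*-cong (toℚᵘ-/ (suc b) 0) (toℚᵘ-/ a b))
    (ℚᵘₚ.≃-trans (*≡* eq) (ℚᵘₚ.≃-sym (toℚᵘ-/ a 0)))))
    where
    eq : (ℤ.+ suc b ℤ.* ℤ.+ a) ℤ.* ℤ.+ 1 ≡ ℤ.+ a ℤ.* ℤ.+ suc (b ℕ.+ 0)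
    eq = trans (ℤₚ.*-identityʳ _) (trans (ℤₚ.*-comm (ℤ.+ suc b) (ℤ.+ a)) (cong (λ z → ℤ.+ a ℤ.* ℤ.+ suc z) (sym (ℕₚ.+-identityʳ b))))

ι-suc : ∀ n → ι (suc n) ≡ 1ℚ + ι n
ι-suc n = trans (ι-+ 1 n) (cong (_+ ι n) ι-1)

-- Most rational inequalities below are proved this way: an explicitly nonnegative slack is named,
-- and the ring solver checks the remaining identity.
≤-from-slack : ∀ {a b} c → 0ℚ ≤ c → b ≡ a + c → a ≤ b
≤-from-slack {a} {b} c 0≤c eq = subst (a ≤_) (sym eq) (subst (_≤ a + c) (+-identityʳ a) (+-monoʳ-≤ a 0≤c))

slack : ∀ {a b} → a ≤ b → 0ℚ ≤ b - a
slack {a} {b} a≤b = subst (_≤ b - a) (+-inverseʳ a) (+-monoˡ-≤ (- a) a≤b)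

0≤+ : ∀ {a b} → 0ℚ ≤ a → 0ℚ ≤ b → 0ℚ ≤ a + b
0≤+ = +-mono-≤

0≤* : ∀ {a b} → 0ℚ ≤ a → 0ℚ ≤ b → 0ℚ ≤ a * b
0≤* {a} {b} 0≤a 0≤b = subst (_≤ a * b) (*-zeroʳ a) (*-monoˡ-≤-nonNeg a {{nonNegative 0≤a}} 0≤b)

0≤frac : ∀ a b → 0ℚ ≤ frac a b
0≤frac a zero    = ≤-refl
0≤frac a (suc b) = nonNegative⁻¹ (frac a (suc b)) {{normalize-nonNeg a (suc b)}}

ι-mono-≤ : ∀ {m n} → m ℕ.≤ n → ι m ≤ ι n
ι-mono-≤ {m} {n} m≤n = ≤-from-slack (ι (n ℕ.∸ m)) (0≤ι _)
  (trans (cong ι (sym (ℕₚ.m+[n∸m]≡n m≤n))) (ι-+ m (n ℕ.∸ m)))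

0<1 : 0ℚ < 1ℚ
0<1 = *<* (+<+ (s≤s z≤n))

0≤1 : 0ℚ ≤ 1ℚ
0≤1 = <⇒≤ 0<1

0<ι : ∀ n → 0ℚ < ι (suc n)
0<ι n = <-≤-trans (subst (0ℚ <_) (sym ι-1) 0<1) (ι-mono-≤ (s≤s z≤n))

ι-mono-< : ∀ {m n} → m ℕ.< n → ι m < ι n
ι-mono-< {m} {n} m<n = <-≤-trans
  (subst₂ _<_ (+-identityˡ (ι m)) (sym (ι-suc m)) (+-monoˡ-< (ι m) 0<1)) (ι-mono-≤ m<n)

*ι-cancel-≤ : ∀ n {a b} → ι (suc n) * a ≤ ι (suc n) * b → a ≤ b
*ι-cancel-≤ n = *-cancelˡ-≤-pos (ι (suc n)) {{positive (0<ι n)}}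

-- The series for 1/e

sgn : ℕ → ℚ → ℚ
sgn l v = if isEven l then v else - v

invFact : ℕ → ℚ
invFact l = frac 1 (l !)

-- Reciprocal factorials are known only through l! times `invFact l` being 1. Multiplying by this
-- form of 1 and regrouping produces (l + 1)!, which cancels against `invFact (suc l)`.
invFact-suc : ∀ l → ι (suc l) * invFact (suc l) ≡ invFact l
invFact-suc l = begin
  ι (suc l) * invFact (suc l)
    ≡⟨ sym (*-identityˡ _) ⟩
  1ℚ * (ι (suc l) * invFact (suc l))
    ≡⟨ cong (_* (ι (suc l) * invFact (suc l))) (sym (!*invFact l)) ⟩
  (ι (l !) * invFact l) * (ι (suc l) * invFact (suc l))
    ≡⟨ solve 4 (λ a b c d → (a :* b) :* (c :* d) := ((c :* a) :* d) :* b) refl (ι (l !)) (invFact l) (ι (suc l)) (invFact (suc l)) ⟩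
  ((ι (suc l) * ι (l !)) * invFact (suc l)) * invFact l
    ≡⟨ cong (λ z → (z * invFact (suc l)) * invFact l) (sym (ι-* (suc l) (l !))) ⟩
  (ι (suc l !) * invFact (suc l)) * invFact l
    ≡⟨ cong (_* invFact l) (!*invFact (suc l)) ⟩
  1ℚ * invFact l
    ≡⟨ *-identityˡ _ ⟩
  invFact l ∎
  where
  open ≡-Reasoning
  open +-*-Solver
  -- `frac` reduces only on a denominator of the form `suc b`; a factorial is nonzero but not a
  -- syntactic successor.
  ι*frac′ : ∀ b → b ≢ 0 → ι b * frac 1 b ≡ 1ℚ
  ι*frac′ zero    b≢0 with () ← b≢0 refl
  ι*frac′ (suc b) _   = trans (ι*frac 1 b) ι-1
  !*invFact : ∀ l → ι (l !) * invFact l ≡ 1ℚ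
  !*invFact l = ι*frac′ (l !) (ℕ.≢-nonZero⁻¹ (l !) {{ℕₚ._!≢0 l}})

-- Binomial coefficients and truncated expansions of (1 - x)^j.

module Binomial (x : ℚ) (0≤x : 0ℚ ≤ x) (x≤1 : x ≤ 1ℚ) where

  open +-*-Solver

  -- B l j = (j choose l) x^l
  B : ℕ → ℕ → ℚ
  B zero    j       = 1ℚ
  B (suc l) zero    = 0ℚ
  B (suc l) (suc j) = B (suc l) j + x * B l j

  0≤B : ∀ l j → 0ℚ ≤ B l j
  0≤B zero    j       = 0≤1
  0≤B (suc l) zero    = ≤-refl
  0≤B (suc l) (suc j) = 0≤+ (0≤B (suc l) j) (0≤* 0≤x (0≤B l j))

  -- This is (l + 1) (j choose l + 1) = (j - l) (j choose l), times x^(l + 1), with the subtracted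
  -- term moved to the left so that no difference of naturals occurs. It follows from Pascal's rule
  -- by induction on `j`.
  absorption : ∀ l j → ι (suc l) * B (suc l) j + ι l * (x * B l j) ≡ ι j * (x * B l j)
  absorption zero    zero    = solve 2 (λ z y → z :* con 0ℚ :+ y := y) refl (ι 1) (ι 0 * (x * 1ℚ))
  absorption (suc l) zero    = solve 4 (λ a b z x → a :* con 0ℚ :+ b :* (x :* con 0ℚ) := z :* (x :* con 0ℚ)) refl
    (ι (suc (suc l))) (ι (suc l)) (ι 0) x
  absorption zero    (suc j) = begin
    ι 1 * (B 1 j + x * 1ℚ) + ι 0 * (x * 1ℚ)
      ≡⟨ solve 4 (λ i z b x → i :* (b :+ x :* con 1ℚ) :+ z :* (x :* con 1ℚ)
                 := (i :* b :+ z :* (x :* con 1ℚ)) :+ i :* x) refl (ι 1) (ι 0) (B 1 j) x ⟩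
    (ι 1 * B 1 j + ι 0 * (x * 1ℚ)) + ι 1 * x
      ≡⟨ cong (λ z → (ι 1 * B 1 j + ι 0 * (x * 1ℚ)) + z) (trans (cong (_* x) ι-1) (*-identityˡ x)) ⟩
    (ι 1 * B 1 j + ι 0 * (x * 1ℚ)) + x
      ≡⟨ cong (_+ x) (absorption zero j) ⟩
    ι j * (x * 1ℚ) + x
      ≡⟨ solve 2 (λ j x → j :* (x :* con 1ℚ) :+ x := (con 1ℚ :+ j) :* (x :* con 1ℚ)) refl (ι j) x ⟩
    (1ℚ + ι j) * (x * 1ℚ)
      ≡⟨ cong (_* (x * 1ℚ)) (sym (ι-suc j)) ⟩
    ι (suc j) * (x * 1ℚ) ∎
    where open ≡-Reasoning
  absorption (suc l) (suc j) = begin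
    ι (2 ℕ.+ l) * (b₂ + x * b₁) + ι (suc l) * (x * (b₁ + x * b₀))
      ≡⟨ cong (λ z → z * (b₂ + x * b₁) + ι (suc l) * (x * (b₁ + x * b₀))) (ι-suc (suc l)) ⟩
    (1ℚ + L) * (b₂ + x * b₁) + L * (x * (b₁ + x * b₀))
      ≡⟨ solve 5 (λ L x b₀ b₁ b₂ → (con 1ℚ :+ L) :* (b₂ :+ x :* b₁) :+ L :* (x :* (b₁ :+ x :* b₀))
            := ((con 1ℚ :+ L) :* b₂ :+ L :* (x :* b₁)) :+ (con 1ℚ :+ L) :* (x :* b₁) :+ L :* (x :* (x :* b₀))) refl L x b₀ b₁ b₂ ⟩
    ((1ℚ + L) * b₂ + L * (x * b₁)) + (1ℚ + L) * (x * b₁) + L * (x * (x * b₀))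
      ≡⟨ cong (λ z → z + (1ℚ + L) * (x * b₁) + L * (x * (x * b₀)))
           (trans (cong (λ z → z * b₂ + L * (x * b₁)) (sym (ι-suc (suc l)))) (absorption (suc l) j)) ⟩
    J * (x * b₁) + (1ℚ + L) * (x * b₁) + L * (x * (x * b₀))
      ≡⟨ cong (λ z → J * (x * b₁) + (1ℚ + L) * (x * b₁) + z * (x * (x * b₀))) (ι-suc l) ⟩
    J * (x * b₁) + (1ℚ + L) * (x * b₁) + (1ℚ + ι l) * (x * (x * b₀))
      ≡⟨ solve 6 (λ J L l x b₀ b₁ → J :* (x :* b₁) :+ (con 1ℚ :+ L) :* (x :* b₁) :+ (con 1ℚ :+ l) :* (x :* (x :* b₀))
            := J :* (x :* b₁) :+ x :* b₁ :+ x :* (L :* b₁ :+ l :* (x :* b₀)) :+ x :* (x :* b₀)) refl J L (ι l) x b₀ b₁ ⟩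
    J * (x * b₁) + x * b₁ + x * (L * b₁ + ι l * (x * b₀)) + x * (x * b₀)
      ≡⟨ cong (λ z → J * (x * b₁) + x * b₁ + x * z + x * (x * b₀)) (absorption l j) ⟩
    J * (x * b₁) + x * b₁ + x * (J * (x * b₀)) + x * (x * b₀)
      ≡⟨ solve 4 (λ J x b₀ b₁ → J :* (x :* b₁) :+ x :* b₁ :+ x :* (J :* (x :* b₀)) :+ x :* (x :* b₀)
            := (con 1ℚ :+ J) :* (x :* (b₁ :+ x :* b₀))) refl J x b₀ b₁ ⟩
    (1ℚ + J) * (x * (b₁ + x * b₀))
      ≡⟨ cong (_* (x * (b₁ + x * b₀))) (sym (ι-suc j)) ⟩
    ι (suc j) * (x * (b₁ + x * b₀)) ∎
    where
    open ≡-Reasoning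
    L = ι (suc l)
    J = ι j
    b₀ = B l j
    b₁ = B (suc l) j
    b₂ = B (suc (suc l)) j

  -- The binomial expansion of (1 - x)^j, cut off after the term of index `l`.
  P : ℕ → ℕ → ℚ
  P zero    j = 1ℚ
  P (suc l) j = P l j + sgn (suc l) (B (suc l) j)

  sgn-suc-step : ∀ l b₁ b₀ → sgn (suc l) (b₁ + x * b₀) ≡ sgn (suc l) b₁ - x * sgn l b₀
  sgn-suc-step l b₁ b₀ with isEven l
  ... | true  = solve 3 (λ x b₁ b₀ → :- (b₁ :+ x :* b₀) := :- b₁ :- x :* b₀) refl x b₁ b₀
  ... | false = solve 3 (λ x b₁ b₀ → b₁ :+ x :* b₀ := b₁ :- x :* (:- b₀)) refl x b₁ b₀

  -- Pascal's rule summed with alternating signs: the sign flip between consecutive indices turns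
  -- the shifted part into `- x * P l j`.
  P-step : ∀ l j → P (suc l) (suc j) ≡ P (suc l) j - x * P l j
  P-step zero    j = solve 2 (λ b x → con 1ℚ :+ :- (b :+ x :* con 1ℚ) := (con 1ℚ :+ :- b) :- x :* con 1ℚ) refl (B 1 j) x
  P-step (suc l) j = begin
    P (suc l) (suc j) + sgn (2 ℕ.+ l) (B (2 ℕ.+ l) j + x * B (suc l) j)
      ≡⟨ cong₂ _+_ (P-step l j) (sgn-suc-step (suc l) (B (2 ℕ.+ l) j) (B (suc l) j)) ⟩
    (P (suc l) j - x * P l j) + (sgn (2 ℕ.+ l) (B (2 ℕ.+ l) j) - x * sgn (suc l) (B (suc l) j))
      ≡⟨ solve 5 (λ x P₁ P₀ s₂ s₁ → (P₁ :- x :* P₀) :+ (s₂ :- x :* s₁) := (P₁ :+ s₂) :- x :* (P₀ :+ s₁)) refl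
           x (P (suc l) j) (P l j) (sgn (2 ℕ.+ l) (B (2 ℕ.+ l) j)) (sgn (suc l) (B (suc l) j)) ⟩
    P (2 ℕ.+ l) j - x * P (suc l) j ∎
    where open ≡-Reasoning

  pow : ℕ → ℚ
  pow zero    = 1ℚ
  pow (suc j) = (1ℚ - x) * pow j

  0≤f : 0ℚ ≤ 1ℚ - x
  0≤f = slack x≤1

  P-zero : ∀ l → P l 0 ≡ 1ℚ
  P-zero zero    = refl
  P-zero (suc l) with isEven l
  ... | true  = trans (cong (_- 0ℚ) (P-zero l)) refl
  ... | false = trans (cong (_+ 0ℚ) (P-zero l)) refl

  -- For even `l` the last term kept has odd index and negative sign. Induction on `j` with `l`
  -- fixed: multiplying the truncation by `1ℚ - x` gives the next truncation plus the nonnegative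
  -- term `x * B (suc l) j`, so the lower bound is inherited.
  bonferroni : ∀ l → isEven l ≡ true → ∀ j → P (suc l) j ≤ pow j
  bonferroni l even zero    = ≤-reflexive (P-zero (suc l))
  bonferroni l even (suc j) = ≤-trans
    (≤-from-slack (x * B (suc l) j) (0≤* 0≤x (0≤B (suc l) j)) eq)
    (*-monoˡ-≤-nonNeg (1ℚ - x) {{nonNegative 0≤f}} (bonferroni l even j))
    where
    eq : (1ℚ - x) * P (suc l) j ≡ P (suc l) (suc j) + x * B (suc l) j
    eq rewrite P-step l j | even = solve 3 (λ x P b → (con 1ℚ :- x) :* (P :+ :- b)
      := ((P :+ :- b) :- x :* P) :+ x :* b) refl x (P l j) (B (suc l) j)

  0≤pow : ∀ j → 0ℚ ≤ pow j
  0≤pow zero    = 0≤1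
  0≤pow (suc j) = 0≤* 0≤f (0≤pow j)

  pow≤1 : ∀ j → pow j ≤ 1ℚ
  pow≤1 zero    = ≤-refl
  pow≤1 (suc j) = ≤-from-slack ((1ℚ - pow j) + x * pow j)
    (0≤+ (slack (pow≤1 j)) (0≤* 0≤x (0≤pow j)))
    (solve 2 (λ x y → con 1ℚ := (con 1ℚ :- x) :* y :+ ((con 1ℚ :- y) :+ x :* y)) refl x (pow j))

  pow≤x+pow-suc : ∀ j → pow j ≤ x + pow (suc j)
  pow≤x+pow-suc j = ≤-from-slack (x * (1ℚ - pow j)) (0≤* 0≤x (slack (pow≤1 j)))
    (solve 2 (λ x y → x :+ (con 1ℚ :- x) :* y := y :+ x :* (con 1ℚ :- y)) refl x (pow j))

  -- Serves to pass from the exponent q + 1, at which the expansion is compared with the series of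
  -- 1/e, to the budget q + 5 at a cost of 4x.
  pow≤ix+pow-+ : ∀ i j → pow j ≤ ι i * x + pow (i ℕ.+ j)
  pow≤ix+pow-+ zero    j = ≤-reflexive (trans (solve 2 (λ x y → y := con 0ℚ :* x :+ y) refl x (pow j))
    (cong (λ z → z * x + pow j) (sym ι-0)))
  pow≤ix+pow-+ (suc i) j = ≤-trans (pow≤ix+pow-+ i j) (≤-trans (+-monoʳ-≤ (ι i * x) (pow≤x+pow-suc (i ℕ.+ j)))
    (≤-reflexive (trans
      (solve 3 (λ i x y → i :* x :+ (x :+ y) := (con 1ℚ :+ i) :* x :+ y) refl (ι i) x (pow (suc i ℕ.+ j)))
      (cong (λ z → z * x + pow (suc i ℕ.+ j)) (sym (ι-suc i))))))

-- Collects the coefficients of the termwise errors `ι i * x` for i from 1 to `l`.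
tri : ℕ → ℕ
tri zero    = 0
tri (suc l) = tri l ℕ.+ suc l

-- Here `x` is 1/p and the exponent is `p`, so `B l p` is (p choose l) / p^l. It lies between 1/l! -
-- lx and 1/l!, which allows the expansion of (1 - 1/p)^p to be compared with the series of 1/e term
-- by term.
module ReciprocalStep (q : ℕ) (x : ℚ) (0≤x : 0ℚ ≤ x) (px≡1 : ι (suc q) * x ≡ 1ℚ) where

  open +-*-Solver

  p : ℕ
  p = suc q

  x≤1 : x ≤ 1ℚ
  x≤1 = *ι-cancel-≤ q (subst₂ _≤_ (sym px≡1) (sym (*-identityʳ (ι p))) (subst (_≤ ι p) ι-1 (ι-mono-≤ (s≤s z≤n))))

  open Binomial x 0≤x x≤1 public

  absorption-p : ∀ l → ι (suc l) * B (suc l) p + ι l * (x * B l p) ≡ B l p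
  absorption-p l = trans (absorption l p) (trans (sym (*-assoc (ι p) x (B l p)))
    (trans (cong (_* B l p) px≡1) (*-identityˡ _)))

  suc*B≤B : ∀ l → ι (suc l) * B (suc l) p ≤ B l p
  suc*B≤B l = ≤-from-slack (ι l * (x * B l p)) (0≤* (0≤ι l) (0≤* 0≤x (0≤B l p))) (sym (absorption-p l))

  B≤invFact : ∀ l → B l p ≤ invFact l
  B≤invFact zero    = ≤-refl
  B≤invFact (suc l) = *ι-cancel-≤ l (≤-trans (suc*B≤B l)
    (≤-trans (B≤invFact l) (≤-reflexive (sym (invFact-suc l)))))

  B≤1 : ∀ l → B l p ≤ 1ℚ
  B≤1 zero    = ≤-refl
  B≤1 (suc l) = ≤-trans
    (≤-from-slack (ι l * B (suc l) p) (0≤* (0≤ι l) (0≤B (suc l) p))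
      (trans (cong (_* B (suc l) p) (ι-suc l))
        (solve 2 (λ l b → (con 1ℚ :+ l) :* b := b :+ l :* b) refl (ι l) (B (suc l) p))))
    (≤-trans (suc*B≤B l) (B≤1 l))

  1≡1+0x : 1ℚ ≡ 1ℚ + ι 0 * x
  1≡1+0x = trans (solve 1 (λ x → con 1ℚ := con 1ℚ :+ con 0ℚ :* x) refl x) (cong (λ z → 1ℚ + z * x) (sym ι-0))

  -- Induction after multiplication by l + 1. By `absorption-p` the loss in one step is lx times
  -- `B l p`, hence at most lx, and the allowance covers it together with the error inherited from
  -- `l` because (l + 1)^2 exceeds 2l.
  invFact≤B : ∀ l → invFact l ≤ B l p + ι l * x
  invFact≤B zero    = ≤-reflexive 1≡1+0x
  invFact≤B (suc l) = *ι-cancel-≤ l (subst (_≤ ι (suc l) * (B (suc l) p + ι (suc l) * x)) (sym (invFact-suc l))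
    (≤-trans (invFact≤B l) (≤-from-slack c 0≤c eq)))
    where
    b₀ = B l p
    b₁ = B (suc l) p
    c = ι l * x * (1ℚ - b₀) + (x + ι l * ι l * x)
    0≤c : 0ℚ ≤ c
    0≤c = 0≤+ (0≤* (0≤* (0≤ι l) 0≤x) (slack (B≤1 l))) (0≤+ 0≤x (0≤* (0≤* (0≤ι l) (0≤ι l)) 0≤x))
    eq : ι (suc l) * (b₁ + ι (suc l) * x) ≡ (b₀ + ι l * x) + c
    eq = begin
      ι (suc l) * (b₁ + ι (suc l) * x)
        ≡⟨ solve 5 (λ L l b₁ b₀ x → L :* (b₁ :+ L :* x) := (L :* b₁ :+ l :* (x :* b₀)) :+ (L :* L :* x :- l :* x :* b₀)) refl
             (ι (suc l)) (ι l) b₁ b₀ x ⟩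
      (ι (suc l) * b₁ + ι l * (x * b₀)) + (ι (suc l) * ι (suc l) * x - ι l * x * b₀)
        ≡⟨ cong₂ (λ y z → y + (z * z * x - ι l * x * b₀)) (absorption-p l) (ι-suc l) ⟩
      b₀ + ((1ℚ + ι l) * (1ℚ + ι l) * x - ι l * x * b₀)
        ≡⟨ solve 3 (λ l b₀ x → b₀ :+ ((con 1ℚ :+ l) :* (con 1ℚ :+ l) :* x :- l :* x :* b₀)
             := (b₀ :+ l :* x) :+ (l :* x :* (con 1ℚ :- b₀) :+ (x :+ l :* l :* x))) refl (ι l) b₀ x ⟩
      (b₀ + ι l * x) + c ∎
      where open ≡-Reasoning

  -- Positive terms use `invFact≤B` and negative ones `B≤invFact`; the common error term lets both
  -- kinds be summed.
  sgn-invFact≤ : ∀ l → sgn l (invFact l) ≤ sgn l (B l p) + ι l * x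
  sgn-invFact≤ l with isEven l
  ... | true  = invFact≤B l
  ... | false = ≤-from-slack ((invFact l - B l p) + ι l * x)
    (0≤+ (slack (B≤invFact l)) (0≤* (0≤ι l) 0≤x))
    (solve 3 (λ e b y → :- b :+ y := :- e :+ ((e :- b) :+ y)) refl (invFact l) (B l p) (ι l * x))

  invEPartial≤P : ∀ l → invEPartial l ≤ P l p + ι (tri l) * x
  invEPartial≤P zero    = ≤-reflexive 1≡1+0x
  invEPartial≤P (suc l) = ≤-trans (+-mono-≤ (invEPartial≤P l) (sgn-invFact≤ (suc l)))
    (≤-reflexive (trans
      (solve 5 (λ P s t l x → (P :+ t :* x) :+ (s :+ l :* x) := (P :+ s) :+ (t :+ l) :* x) refl
        (P l p) (sgn (suc l) (B (suc l) p)) (ι (tri l)) (ι (suc l)) x)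
      (cong (λ z → P (suc l) p + z * x) (sym (ι-+ (tri l) (suc l))))))

  isEven-+2 : ∀ l → isEven (2 ℕ.+ l) ≡ isEven l
  isEven-+2 l with isEven l
  ... | true  = refl
  ... | false = refl

  isEven-2* : ∀ m → isEven (2 ℕ.* m) ≡ true
  isEven-2* zero    = refl
  isEven-2* (suc m) = trans (cong isEven (ℕₚ.*-suc 2 m)) (trans (isEven-+2 (2 ℕ.* m)) (isEven-2* m))

  -- The truncation at 2m bounds (1 - x)^p from the wrong side. Including the next term, of odd
  -- index, makes it a lower bound, so the even truncation exceeds the power by at most that one
  -- term.
  invEUpper≤pow : ∀ m → invEUpper m ≤ (pow p + B (suc (2 ℕ.* m)) p) + ι (tri (2 ℕ.* m)) * x
  invEUpper≤pow m = ≤-trans (invEPartial≤P (2 ℕ.* m)) (+-monoˡ-≤ (ι (tri (2 ℕ.* m)) * x)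
    (≤-trans (≤-reflexive eq) (+-monoˡ-≤ (B (suc (2 ℕ.* m)) p) (bonferroni (2 ℕ.* m) (isEven-2* m) p))))
    where
    eq : P (2 ℕ.* m) p ≡ P (suc (2 ℕ.* m)) p + B (suc (2 ℕ.* m)) p
    eq rewrite isEven-2* m = solve 2 (λ P b → P := (P :+ :- b) :+ b) refl (P (2 ℕ.* m) p) (B (suc (2 ℕ.* m)) p)

-- Choice of the parameters for a given ε.

recip≤ : ∀ ε → 0ℚ < ε → ∃ λ d → 1ℚ ≤ ι (suc d) * ε
recip≤ ε@(mkℚ (ℤ.+ suc n) d _) _ = d , subst (1ℚ ≤_)
  (trans (sym (ι*frac (suc n) d)) (cong (ι (suc d) *_) (↥p/↧p≡p ε))) (subst (_≤ ι (suc n)) ι-1 (ι-mono-≤ (s≤s z≤n)))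
recip≤ (mkℚ (ℤ.+ zero) d _) (*<* (+<+ ()))
recip≤ (mkℚ (ℤ.-[1+ n ]) d _) (*<* ())

reciprocal : ∀ n → ∃ λ x → 0ℚ ≤ x × ι (suc n) * x ≡ 1ℚ
reciprocal n = frac 1 (suc n) , 0≤frac 1 (suc n) , trans (ι*frac 1 n) ι-1

-- `x` is 1/(q + 1) and `y` is (q/(q + 1))^(q + 5), both specified by an equation instead of a
-- division. The reserve 4x pays for the losses of the instance: three for the O's that a seed may
-- contain and one for the noise.
EApproximation : ℚ → Set
EApproximation ε = ∃ λ q → 1 ℕ.≤ q × ∃ λ m → ∃ λ x → ∃ λ y →
  ι (suc q) * x ≡ 1ℚ × ι (suc q ℕ.^ (5 ℕ.+ q)) * y ≡ ι (q ℕ.^ (5 ℕ.+ q)) ×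
  invEUpper m + ι 4 * x ≤ y + ε

-- With 1 ≤ dε and δ = 1/(2d), the series is cut at m = d, and q = 2dt for t =
-- `tri (2 ℕ.* d) ℕ.+ 8`. The first omitted term is at most 1/(2d + 1), and the other errors add up
-- to tx, at most δ; together they stay within 2δ ≤ ε.
e-approximation : ∀ ε → 0ℚ < ε → EApproximation ε
e-approximation ε 0<ε = chooseδ (recip≤ ε 0<ε)
  where
  fromReciprocals : ∀ d d-1 → suc d-1 ≡ d → 1ℚ ≤ ι d * ε → ∀ d₂-1 → suc d₂-1 ≡ 2 ℕ.* d →
    ∀ δ → ι (suc d₂-1) * δ ≡ 1ℚ → ∀ t → t ≡ tri (2 ℕ.* d) ℕ.+ 8 → ∀ q → q ≡ suc d₂-1 ℕ.* t →
    ∀ x → 0ℚ ≤ x → (px≡1 : ι (suc q) * x ≡ 1ℚ) →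
    ∃ λ y → ι (suc q ℕ.^ (5 ℕ.+ q)) * y ≡ ι (q ℕ.^ (5 ℕ.+ q)) × invEUpper d + ι 4 * x ≤ y + ε
  fromReciprocals d d-1 d≡ 1≤dε d₂-1 d₂≡2d δ d₂δ≡1 t t≡ q q≡ x 0≤x px≡1 = pow (5 ℕ.+ q) , pow-value (5 ℕ.+ q) , final
    where
    open ReciprocalStep q x 0≤x px≡1
    open ≤-Reasoning
    open +-*-Solver
    b = B (suc (2 ℕ.* d)) p
    T = ι (tri (2 ℕ.* d))
    pf≡q : ι p * (1ℚ - x) ≡ ι q
    pf≡q = begin-equality
      ι p * (1ℚ - x)    ≡⟨ solve 2 (λ p x → p :* (con 1ℚ :- x) := p :- p :* x) refl (ι p) x ⟩
      ι p - ι p * x     ≡⟨ cong₂ _-_ (ι-suc q) px≡1 ⟩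
      (1ℚ + ι q) - 1ℚ   ≡⟨ solve 1 (λ q → (con 1ℚ :+ q) :- con 1ℚ := q) refl (ι q) ⟩
      ι q               ∎
    pow-value : ∀ j → ι (p ℕ.^ j) * pow j ≡ ι (q ℕ.^ j)
    pow-value zero    = *-identityʳ (ι 1)
    pow-value (suc j) = begin-equality
      ι (p ℕ.* p ℕ.^ j) * ((1ℚ - x) * pow j)
        ≡⟨ cong (_* ((1ℚ - x) * pow j)) (ι-* p (p ℕ.^ j)) ⟩
      (ι p * ι (p ℕ.^ j)) * ((1ℚ - x) * pow j)
        ≡⟨ solve 4 (λ p P f y → (p :* P) :* (f :* y) := (p :* f) :* (P :* y)) refl (ι p) (ι (p ℕ.^ j)) (1ℚ - x) (pow j) ⟩
      (ι p * (1ℚ - x)) * (ι (p ℕ.^ j) * pow j)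
        ≡⟨ cong₂ _*_ pf≡q (pow-value j) ⟩
      ι q * ι (q ℕ.^ j)
        ≡⟨ sym (ι-* q (q ℕ.^ j)) ⟩
      ι (q ℕ.* q ℕ.^ j) ∎
    0≤b : 0ℚ ≤ b
    0≤b = 0≤B (suc (2 ℕ.* d)) p
    b≤δ : b ≤ δ
    b≤δ = *ι-cancel-≤ d₂-1 (begin
      ι (suc d₂-1) * b         ≡⟨ cong (λ z → ι z * b) d₂≡2d ⟩
      ι (2 ℕ.* d) * b          ≤⟨ *-monoʳ-≤-nonNeg b {{nonNegative 0≤b}} (ι-mono-≤ (ℕₚ.n≤1+n (2 ℕ.* d))) ⟩
      ι (suc (2 ℕ.* d)) * b    ≤⟨ suc*B≤B (2 ℕ.* d) ⟩
      B (2 ℕ.* d) p            ≤⟨ B≤1 (2 ℕ.* d) ⟩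
      1ℚ                       ≡⟨ sym d₂δ≡1 ⟩
      ι (suc d₂-1) * δ         ∎)
    tx≤δ : ι t * x ≤ δ
    tx≤δ = *ι-cancel-≤ d₂-1 (begin
      ι (suc d₂-1) * (ι t * x)   ≡⟨ sym (*-assoc (ι (suc d₂-1)) (ι t) x) ⟩
      ι (suc d₂-1) * ι t * x     ≡⟨ cong (_* x) (sym (trans (cong ι q≡) (ι-* (suc d₂-1) t))) ⟩
      ι q * x                    ≤⟨ *-monoʳ-≤-nonNeg x {{nonNegative 0≤x}} (ι-mono-≤ (ℕₚ.n≤1+n q)) ⟩
      ι p * x                    ≡⟨ px≡1 ⟩
      1ℚ                         ≡⟨ sym d₂δ≡1 ⟩
      ι (suc d₂-1) * δ           ∎)
    ι2≡ : ι 2 ≡ 1ℚ + 1ℚ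
    ι2≡ = trans (ι-suc 1) (cong (λ z → 1ℚ + z) ι-1)
    2δ≤ε : δ + δ ≤ ε
    2δ≤ε = *ι-cancel-≤ d-1 (begin
      ι (suc d-1) * (δ + δ)  ≡⟨ cong (λ z → ι z * (δ + δ)) d≡ ⟩
      ι d * (δ + δ)         ≡⟨ solve 2 (λ d y → d :* (y :+ y) := ((con 1ℚ :+ con 1ℚ) :* d) :* y) refl (ι d) δ ⟩
      (1ℚ + 1ℚ) * ι d * δ   ≡⟨ cong (λ z → z * ι d * δ) (sym ι2≡) ⟩
      ι 2 * ι d * δ         ≡⟨ cong (_* δ) (trans (sym (ι-* 2 d)) (cong ι (sym d₂≡2d))) ⟩
      ι (suc d₂-1) * δ      ≡⟨ d₂δ≡1 ⟩
      1ℚ                    ≤⟨ 1≤dε ⟩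
      ι d * ε               ≡⟨ cong (λ z → ι z * ε) (sym d≡) ⟩
      ι (suc d-1) * ε       ∎)
    -- The 8 in `t` consists of 4 for raising the exponent from `p` to `4 ℕ.+ p` and 4 for the
    -- reserve.
    final : invEUpper d + ι 4 * x ≤ pow (5 ℕ.+ q) + ε
    final = begin
      invEUpper d + ι 4 * x
        ≤⟨ +-monoˡ-≤ (ι 4 * x) (invEUpper≤pow d) ⟩
      ((pow p + b) + T * x) + ι 4 * x
        ≤⟨ +-monoˡ-≤ (ι 4 * x) (+-monoˡ-≤ (T * x) (+-monoˡ-≤ b (pow≤ix+pow-+ 4 p))) ⟩
      (((ι 4 * x + pow (4 ℕ.+ p)) + b) + T * x) + ι 4 * x
        ≡⟨ solve 5 (λ x y b T F → (((F :* x :+ y) :+ b) :+ T :* x) :+ F :* x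
             := y :+ (b :+ (T :+ (F :+ F)) :* x)) refl x (pow (4 ℕ.+ p)) b T (ι 4) ⟩
      pow (4 ℕ.+ p) + (b + (T + (ι 4 + ι 4)) * x)
        ≡⟨ cong (λ z → pow (4 ℕ.+ p) + (b + z * x)) (trans (trans (cong (λ z → T + z) (sym (ι-+ 4 4)))
             (sym (ι-+ (tri (2 ℕ.* d)) 8))) (cong ι (sym t≡))) ⟩
      pow (4 ℕ.+ p) + (b + ι t * x)
        ≤⟨ +-monoʳ-≤ (pow (4 ℕ.+ p)) (+-mono-≤ b≤δ tx≤δ) ⟩
      pow (4 ℕ.+ p) + (δ + δ)
        ≤⟨ +-monoʳ-≤ (pow (4 ℕ.+ p)) 2δ≤ε ⟩
      pow (4 ℕ.+ p) + ε
        ≡⟨ cong (λ j → pow j + ε) (ℕₚ.+-suc 4 q) ⟩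
      pow (5 ℕ.+ q) + ε ∎

  chooseX : ∀ d d-1 → suc d-1 ≡ d → 1ℚ ≤ ι d * ε → ∀ d₂-1 → suc d₂-1 ≡ 2 ℕ.* d →
    ∀ δ → ι (suc d₂-1) * δ ≡ 1ℚ → ∀ t → t ≡ tri (2 ℕ.* d) ℕ.+ 8 → ∀ q → q ≡ suc d₂-1 ℕ.* t → 1 ℕ.≤ q →
    (∃ λ x → 0ℚ ≤ x × ι (suc q) * x ≡ 1ℚ) → EApproximation ε
  chooseX d d-1 d≡ 1≤dε d₂-1 d₂≡ δ d₂δ≡1 t t≡ q q≡ 1≤q (x , 0≤x , px≡1) = q , 1≤q , d , x , proj₁ z , px≡1 , proj₂ z
    where
    z = fromReciprocals d d-1 d≡ 1≤dε d₂-1 d₂≡ δ d₂δ≡1 t t≡ q q≡ x 0≤x px≡1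

  chooseQ : ∀ d d-1 → suc d-1 ≡ d → 1ℚ ≤ ι d * ε → ∀ d₂-1 → suc d₂-1 ≡ 2 ℕ.* d →
    (∃ λ δ → 0ℚ ≤ δ × ι (suc d₂-1) * δ ≡ 1ℚ) → ∀ t → t ≡ tri (2 ℕ.* d) ℕ.+ 8 → 1 ℕ.≤ t → EApproximation ε
  chooseQ d d-1 d≡ 1≤dε d₂-1 d₂≡ (δ , _ , d₂δ≡1) t t≡ 1≤t =
    chooseX d d-1 d≡ 1≤dε d₂-1 d₂≡ δ d₂δ≡1 t t≡ (suc d₂-1 ℕ.* t) refl
      (ℕₚ.*-mono-≤ (s≤s {n = d₂-1} z≤n) 1≤t) (reciprocal (suc d₂-1 ℕ.* t))

  chooseδ : (∃ λ d-1 → 1ℚ ≤ ι (suc d-1) * ε) → EApproximation ε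
  chooseδ (d-1 , 1≤dε) = chooseQ (suc d-1) d-1 refl 1≤dε _ refl (reciprocal (d-1 ℕ.+ suc (d-1 ℕ.+ 0))) _ refl
    (ℕₚ.≤-trans {1} {8} (s≤s z≤n) (ℕₚ.m≤n+m 8 (tri (2 ℕ.* suc d-1))))

-- Bounds for fractions and for sums over all nodes.

frac≤1 : ∀ {a b} → a ℕ.≤ b → frac a b ≤ 1ℚ
frac≤1 {b = zero}      a≤b = 0≤1
frac≤1 {a} {b = suc b} a≤b = *ι-cancel-≤ b (≤-trans (≤-reflexive (ι*frac a b))
  (≤-trans (ι-mono-≤ a≤b) (≤-reflexive (sym (*-identityʳ (ι (suc b)))))))

1≤frac : ∀ {a b} → b ≢ 0 → b ℕ.≤ a → 1ℚ ≤ frac a b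
1≤frac {b = zero}      b≢0 b≤a = contradiction refl b≢0
1≤frac {a} {b = suc b} b≢0 b≤a = *ι-cancel-≤ b (≤-trans (≤-reflexive (*-identityʳ (ι (suc b))))
  (≤-trans (ι-mono-≤ b≤a) (≤-reflexive (sym (ι*frac a b)))))

frac≤0 : ∀ b → frac 0 b ≤ 0ℚ
frac≤0 zero    = ≤-refl
frac≤0 (suc b) = *ι-cancel-≤ b (≤-reflexive (trans (ι*frac 0 b) (trans ι-0 (sym (*-zeroʳ (ι (suc b)))))))

-- The correction `g` stands on the side of `F`, so all that surrounds `F` is a sum of naturals,
-- which can be rearranged in `ℕ` without subtraction.
sumℚ-lower : ∀ {n} (f g : Fin n → ℕ) (F : Fin n → ℚ) → (∀ i → ι (f i) ≤ F i + ι (g i)) →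
  ι (sum f) ≤ sumℚ (map F (allFin n)) + ι (sum g)
sumℚ-lower {n} f g F f≤F+g = subst (λ l → ι (sum f) ≤ sumℚ l + ι (sum g)) (sym (map-tabulate {n = n} id F)) (go f g F f≤F+g)
  where
  go : ∀ {n} (f g : Fin n → ℕ) (F : Fin n → ℚ) → (∀ i → ι (f i) ≤ F i + ι (g i)) →
    ι (sum f) ≤ sumℚ (tabulate F) + ι (sum g)
  go {zero}  f g F h = ≤-reflexive (sym (+-identityˡ (ι 0)))
  go {suc n} f g F h = begin
    ι (f zero ℕ.+ sum (f ∘ suc))                          ≡⟨ ι-+ (f zero) _ ⟩
    ι (f zero) + ι (sum (f ∘ suc))                        ≤⟨ +-mono-≤ (h zero) (go (f ∘ suc) (g ∘ suc) (F ∘ suc) (h ∘ suc)) ⟩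
    (F zero + ι (g zero)) + (sumℚ (tabulate (F ∘ suc)) + ι (sum (g ∘ suc)))
      ≡⟨ interchange (F zero) (ι (g zero)) (sumℚ (tabulate (F ∘ suc))) (ι (sum (g ∘ suc))) ⟩
    (F zero + sumℚ (tabulate (F ∘ suc))) + (ι (g zero) + ι (sum (g ∘ suc)))
      ≡⟨ cong (λ z → (F zero + sumℚ (tabulate (F ∘ suc))) + z) (sym (ι-+ (g zero) _)) ⟩
    (F zero + sumℚ (tabulate (F ∘ suc))) + ι (g zero ℕ.+ sum (g ∘ suc)) ∎
    where
    open ≤-Reasoning

sumℚ-upper : ∀ {n} (f g : Fin n → ℕ) (F : Fin n → ℚ) → (∀ i → F i + ι (g i) ≤ ι (f i)) →
  sumℚ (map F (allFin n)) + ι (sum g) ≤ ι (sum f)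
sumℚ-upper {n} f g F F+g≤f = subst (λ l → sumℚ l + ι (sum g) ≤ ι (sum f)) (sym (map-tabulate {n = n} id F)) (go f g F F+g≤f)
  where
  go : ∀ {n} (f g : Fin n → ℕ) (F : Fin n → ℚ) → (∀ i → F i + ι (g i) ≤ ι (f i)) →
    sumℚ (tabulate F) + ι (sum g) ≤ ι (sum f)
  go {zero}  f g F h = ≤-reflexive (+-identityˡ (ι 0))
  go {suc n} f g F h = begin
    (F zero + sumℚ (tabulate (F ∘ suc))) + ι (g zero ℕ.+ sum (g ∘ suc))
      ≡⟨ cong (λ z → (F zero + sumℚ (tabulate (F ∘ suc))) + z) (ι-+ (g zero) _) ⟩
    (F zero + sumℚ (tabulate (F ∘ suc))) + (ι (g zero) + ι (sum (g ∘ suc)))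
      ≡⟨ interchange (F zero) (sumℚ (tabulate (F ∘ suc))) (ι (g zero)) (ι (sum (g ∘ suc))) ⟩
    (F zero + ι (g zero)) + (sumℚ (tabulate (F ∘ suc)) + ι (sum (g ∘ suc)))
      ≤⟨ +-mono-≤ (h zero) (go (f ∘ suc) (g ∘ suc) (F ∘ suc) (h ∘ suc)) ⟩
    ι (f zero) + ι (sum (f ∘ suc))                        ≡⟨ sym (ι-+ (f zero) _) ⟩
    ι (f zero ℕ.+ sum (f ∘ suc))                          ∎
    where
    open ≤-Reasoning

sum-↑ : ∀ m {n} (f : Fin (m ℕ.+ n) → ℕ) → sum f ≡ sum (f ∘ (_↑ˡ n)) ℕ.+ sum (f ∘ (m ↑ʳ_))
sum-↑ zero    f = refl
sum-↑ (suc m) f = trans (cong (f zero ℕ.+_) (sum-↑ m (f ∘ suc))) (sym (ℕₚ.+-assoc (f zero) _ _))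

sum-product : ∀ {m n} (f : Fin m → ℕ) (g : Fin n → ℕ) → sum (λ i → sum (λ j → f i ℕ.* g j)) ≡ sum f ℕ.* sum g
sum-product f g = trans (sum-cong-≗ (λ i → sym (*-distribˡ-sum (f i) g))) (sym (*-distribʳ-sum (sum g) f))

sum-const : ∀ n c → sum {n} (λ _ → c) ≡ n ℕ.* c
sum-const zero    c = refl
sum-const (suc n) c = cong (c ℕ.+_) (sum-const n c)

indicator : Bool → ℕ
indicator b = if b then 1 else 0

sum-indicator : ∀ {n} (C : Subset n) → sum (indicator ∘ lookup C) ≡ ∣ C ∣
sum-indicator []          = refl
sum-indicator (true  ∷ C) = cong suc (sum-indicator C)
sum-indicator (false ∷ C) = sum-indicator C

sum-indicator-not : ∀ {n} (P : Fin n → Bool) → sum (indicator ∘ not ∘ P) ℕ.+ sum (indicator ∘ P) ≡ n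
sum-indicator-not {n} P = trans (sym (∑-distrib-+ (indicator ∘ not ∘ P) (indicator ∘ P)))
  (trans (sum-cong-≗ (λ i → complement (P i))) (trans (sum-const n 1) (ℕₚ.*-identityʳ n)))
  where
  complement : ∀ b → indicator (not b) ℕ.+ indicator b ≡ 1
  complement true  = refl
  complement false = refl

-- Walks and shortest paths

module Paths {n : ℕ} (G : Graph n) where

  walks-zero⁻ : ∀ {s t p} → p ∈ walks G 0 s t → s ≡ t × p ≡ s ∷ []
  walks-zero⁻ {s} {t} p∈ with s ≟F t
  walks-zero⁻ (here p≡) | yes s≡t = s≡t , p≡

  walks-zero⁺ : ∀ s → (s ∷ []) ∈ walks G 0 s s
  walks-zero⁺ s with s ≟F s
  ... | yes _  = here refl
  ... | no s≢s = contradiction refl s≢s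

  walks-suc⁻ : ∀ {L s t p} → p ∈ walks G (suc L) s t →
    ∃ λ v → ∃ λ p′ → adj G s v ≡ true × p′ ∈ walks G L v t × p ≡ s ∷ p′
  walks-suc⁻ {L} {s} {t} p∈
    with find (∈-concatMap⁻ (λ v → if adj G s v then map (s ∷_) (walks G L v t) else []) {xs = allFin n} p∈)
  ... | v , _ , p∈v with adj G s v in s~v
  ...   | true with p′ , p′∈ , p≡ ← ∈-map⁻ (s ∷_) p∈v = v , p′ , s~v , p′∈ , p≡

  walks-suc⁺ : ∀ {L s v t p} → adj G s v ≡ true → p ∈ walks G L v t → (s ∷ p) ∈ walks G (suc L) s t
  walks-suc⁺ {L} {s} {v} {t} {p} s~v p∈ =
    ∈-concatMap⁺ (λ v → if adj G s v then map (s ∷_) (walks G L v t) else []) (lose (∈-allFin v) lemma)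
    where
    lemma : (s ∷ p) ∈ (if adj G s v then map (s ∷_) (walks G L v t) else [])
    lemma rewrite s~v = ∈-map⁺ (s ∷_) p∈

  no-members : ∀ {a} {A : Set a} {xs : List A} → (∀ {x} → ¬ x ∈ xs) → xs ≡ []
  no-members {xs = []}     _    = refl
  no-members {xs = x ∷ xs} none = contradiction (here refl) none

  member⇒≢[] : ∀ {a} {A : Set a} {x : A} {xs : List A} → x ∈ xs → xs ≢ []
  member⇒≢[] (here _) ()

  Reachable : Fin n → Fin n → Set
  Reachable s t = ∃ λ L → ∃ λ p → p ∈ walks G L s t

  edge : ∀ {s t} → adj G s t ≡ true → Reachable s t
  edge {s} {t} s~t = 1 , s ∷ t ∷ [] , walks-suc⁺ {L = 0} s~t (walks-zero⁺ t)

  walk-then : ∀ L {s v t p} → p ∈ walks G L s v → Reachable v t → Reachable s t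
  walk-then zero    p∈ r with refl , _ ← walks-zero⁻ p∈ = r
  walk-then (suc L) p∈ r with u , p′ , s~u , p′∈ , _ ← walks-suc⁻ {L} p∈
    with L′ , q , q∈ ← walk-then L p′∈ r = suc L′ , _ ∷ q , walks-suc⁺ {L = L′} s~u q∈

  reachable-trans : ∀ {s v t} → Reachable s v → Reachable v t → Reachable s t
  reachable-trans (L , _ , p∈) r = walk-then L p∈ r

  walk-back : ∀ L {s t p} → p ∈ walks G L s t → Reachable t s
  walk-back zero    p∈ with refl , _ ← walks-zero⁻ p∈ = 0 , _ , walks-zero⁺ _
  walk-back (suc L) {s} p∈ with u , p′ , s~u , p′∈ , _ ← walks-suc⁻ {L} p∈ =
    reachable-trans (walk-back L p′∈) (edge (trans (Graph.sym G u s) s~u))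

  reachable-sym : ∀ {s t} → Reachable s t → Reachable t s
  reachable-sym (L , _ , p∈) = walk-back L p∈

  connected-via : ∀ hub → (∀ s → Reachable s hub) → Connected G
  connected-via hub to-hub s t with L , p , p∈ ← reachable-trans (to-hub s) (reachable-sym (to-hub t)) =
    L , member⇒≢[] p∈

  -- `dist` searches with fuel `n`. Matching on the bound for `n` exposes enough successors for the
  -- search to unfold up to the first nonempty list of walks.
  dist≡1 : 2 ℕ.≤ n → ∀ {s t} → walks G 0 s t ≡ [] → walks G 1 s t ≢ [] → dist G s t ≡ 1
  dist≡1 (s≤s (s≤s z≤n)) {s} {t} w₀ w₁ rewrite w₀ with walks G 1 s t
  ... | []    = contradiction refl w₁
  ... | _ ∷ _ = refl

  dist≡3 : 4 ℕ.≤ n → ∀ {s t} → walks G 0 s t ≡ [] → walks G 1 s t ≡ [] → walks G 2 s t ≡ [] →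
    walks G 3 s t ≢ [] → dist G s t ≡ 3
  dist≡3 (s≤s (s≤s (s≤s (s≤s z≤n)))) {s} {t} w₀ w₁ w₂ w₃ rewrite w₀ | w₁ | w₂ with walks G 3 s t
  ... | []    = contradiction refl w₃
  ... | _ ∷ _ = refl

  -- The summand of `GBC` repeated literally, so that `GBC G C` is by definition its double sum and
  -- bounds for single pairs can be summed directly.
  pairValue : Subset n → Fin n → Fin n → ℚ
  pairValue C s t = if does (s ≟F t) then 0ℚ else frac (σ[_] G C s t) (σ G s t)

  Hit : Subset n → List (Fin n) → Set
  Hit C = Any (λ v → lookup C v ≡ true)

  σ[]≤σ : ∀ C s t → σ[_] G C s t ℕ.≤ σ G s t
  σ[]≤σ C s t = length-filter (Any.any? (λ v → Bool._≟_ (lookup C v) true)) (shortestPaths G s t)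

  0≤pairValue : ∀ C s t → 0ℚ ≤ pairValue C s t
  0≤pairValue C s t with does (s ≟F t)
  ... | true  = ≤-refl
  ... | false = 0≤frac (σ[_] G C s t) (σ G s t)

  pairValue≤1 : ∀ C s t → pairValue C s t ≤ 1ℚ
  pairValue≤1 C s t with does (s ≟F t)
  ... | true  = 0≤1
  ... | false = frac≤1 (σ[]≤σ C s t)

  pairValue-missed : ∀ C s t → (∀ {p} → p ∈ shortestPaths G s t → ¬ Hit C p) → pairValue C s t ≤ 0ℚ
  pairValue-missed C s t missed with does (s ≟F t)
  ... | true  = ≤-refl
  ... | false = subst (λ z → frac z (σ G s t) ≤ 0ℚ) (sym (cong length (filter-none _ (All.tabulate missed)))) (frac≤0 (σ G s t))

  pairValue-hit : ∀ C s t → s ≢ t → shortestPaths G s t ≢ [] → (∀ {p} → p ∈ shortestPaths G s t → Hit C p) →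
    1ℚ ≤ pairValue C s t
  pairValue-hit C s t s≢t nonempty hit with s ≟F t
  ... | yes s≡t = contradiction s≡t s≢t
  ... | no  _   = 1≤frac (λ σ≡0 → nonempty (length≡0 σ≡0))
    (ℕₚ.≤-reflexive (sym (cong length (filter-all (Any.any? (λ v → Bool._≟_ (lookup C v) true)) (All.tabulate hit)))))
    where
    length≡0 : ∀ {a} {A : Set a} {xs : List A} → length xs ≡ 0 → xs ≡ []
    length≡0 {xs = []} _ = refl

  GBC-lower : ∀ C (f g : Fin n → Fin n → ℕ) → (∀ s t → ι (f s t) ≤ pairValue C s t + ι (g s t)) →
    ι (sum λ s → sum (f s)) ≤ GBC G C + ι (sum λ s → sum (g s))
  GBC-lower C f g h = sumℚ-lower _ _ _ (λ s → sumℚ-lower (f s) (g s) (pairValue C s) (h s))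

  GBC-upper : ∀ C (f g : Fin n → Fin n → ℕ) → (∀ s t → pairValue C s t + ι (g s t) ≤ ι (f s t)) →
    GBC G C + ι (sum λ s → sum (g s)) ≤ ι (sum λ s → sum (f s))
  GBC-upper C f g h = sumℚ-upper _ _ _ (λ s → sumℚ-upper (f s) (g s) (pairValue C s) (h s))

-- The gadget

module Gadget {K k A B : ℕ} (ox : Fin A → Fin K) (oy : Fin B → Fin k) where

  -- Arguments about the graph are case distinctions on this type; `enc` and `dec` carry them to
  -- `Fin N`, which is cut into four consecutive blocks.
  data Node : Set where
    S : Fin K → Node
    O : Fin k → Node
    X : Fin A → Node
    Y : Fin B → Node

  N : ℕ
  N = K ℕ.+ (k ℕ.+ (A ℕ.+ B))

  enc : Node → Fin N
  enc (S i) = i ↑ˡ (k ℕ.+ (A ℕ.+ B))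
  enc (O j) = K ↑ʳ (j ↑ˡ (A ℕ.+ B))
  enc (X x) = K ↑ʳ (k ↑ʳ (x ↑ˡ B))
  enc (Y y) = K ↑ʳ (k ↑ʳ (A ↑ʳ y))

  dec : Fin N → Node
  dec v = [ S , [ O , [ X , Y ] ∘ splitAt A ] ∘ splitAt k ] (splitAt K v)

  dec-enc : ∀ a → dec (enc a) ≡ a
  dec-enc (S i) rewrite splitAt-↑ˡ K i (k ℕ.+ (A ℕ.+ B)) = refl
  dec-enc (O j) rewrite splitAt-↑ʳ K (k ℕ.+ (A ℕ.+ B)) (j ↑ˡ (A ℕ.+ B)) | splitAt-↑ˡ k j (A ℕ.+ B) = refl
  dec-enc (X x) rewrite splitAt-↑ʳ K (k ℕ.+ (A ℕ.+ B)) (k ↑ʳ (x ↑ˡ B)) | splitAt-↑ʳ k (A ℕ.+ B) (x ↑ˡ B) | splitAt-↑ˡ A x B = refl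
  dec-enc (Y y) rewrite splitAt-↑ʳ K (k ℕ.+ (A ℕ.+ B)) (k ↑ʳ (A ↑ʳ y)) | splitAt-↑ʳ k (A ℕ.+ B) (A ↑ʳ y) | splitAt-↑ʳ A B y = refl

  enc-dec : ∀ v → enc (dec v) ≡ v
  enc-dec v with splitAt K v in eq₁
  ... | inj₁ i = splitAt⁻¹-↑ˡ eq₁
  ... | inj₂ r with splitAt k r in eq₂
  ...   | inj₁ j = trans (cong (K ↑ʳ_) (splitAt⁻¹-↑ˡ eq₂)) (splitAt⁻¹-↑ʳ {m = K} eq₁)
  ...   | inj₂ r′ with splitAt A r′ in eq₃
  ...     | inj₁ x = trans (cong (λ z → K ↑ʳ (k ↑ʳ z)) (splitAt⁻¹-↑ˡ eq₃))
                       (trans (cong (K ↑ʳ_) (splitAt⁻¹-↑ʳ {m = k} eq₂)) (splitAt⁻¹-↑ʳ {m = K} eq₁))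
  ...     | inj₂ y = trans (cong (λ z → K ↑ʳ (k ↑ʳ z)) (splitAt⁻¹-↑ʳ {m = A} eq₃))
                       (trans (cong (K ↑ʳ_) (splitAt⁻¹-↑ʳ {m = k} eq₂)) (splitAt⁻¹-↑ʳ {m = K} eq₁))

  enc-injective : ∀ {a b} → enc a ≡ enc b → a ≡ b
  enc-injective {a} {b} eq = trans (sym (dec-enc a)) (trans (cong dec eq) (dec-enc b))

  sum-dec : ∀ (h : Node → ℕ) → sum (h ∘ dec) ≡
    sum (h ∘ S) ℕ.+ (sum (h ∘ O) ℕ.+ (sum (h ∘ X) ℕ.+ sum (h ∘ Y)))
  sum-dec h = trans (sum-↑ K (h ∘ dec)) (cong₂ ℕ._+_ (sum-cong-≗ (λ i → cong h (dec-enc (S i))))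
    (trans (sum-↑ k _) (cong₂ ℕ._+_ (sum-cong-≗ (λ j → cong h (dec-enc (O j))))
    (trans (sum-↑ A _) (cong₂ ℕ._+_ (sum-cong-≗ (λ x → cong h (dec-enc (X x))))
                                    (sum-cong-≗ (λ y → cong h (dec-enc (Y y)))))))))

  -- The cliques put any two pendants of one cloud at distance 1. The shortest path of such a pair
  -- has no inner node, so the pair contributes only when an endpoint is chosen.
  adjacent : Node → Node → Bool
  adjacent (S i) (O j)  = true
  adjacent (O j) (S i)  = true
  adjacent (S i) (X x)  = does (ox x ≟F i)
  adjacent (X x) (S i)  = does (ox x ≟F i)
  adjacent (O j) (Y y)  = does (oy y ≟F j)
  adjacent (Y y) (O j)  = does (oy y ≟F j)
  adjacent (X x) (X x′) = not (does (x ≟F x′))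
  adjacent (Y y) (Y y′) = not (does (y ≟F y′))
  adjacent _     _      = false

  does-≟-sym : ∀ {n} (u v : Fin n) → does (u ≟F v) ≡ does (v ≟F u)
  does-≟-sym u v with u ≟F v | v ≟F u
  ... | yes _   | yes _   = refl
  ... | no  _   | no  _   = refl
  ... | yes u≡v | no v≢u  = contradiction (sym u≡v) v≢u
  ... | no u≢v  | yes v≡u = contradiction (sym v≡u) u≢v

  does-≟-refl : ∀ {n} (u : Fin n) → does (u ≟F u) ≡ true
  does-≟-refl u with u ≟F u
  ... | yes _  = refl
  ... | no u≢u = contradiction refl u≢u

  does-≟⇒≡ : ∀ {n} {u v : Fin n} → does (u ≟F v) ≡ true → u ≡ v
  does-≟⇒≡ {u = u} {v} eq with u ≟F v
  ... | yes u≡v = u≡v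

  adjacent-sym : ∀ a b → adjacent a b ≡ adjacent b a
  adjacent-sym (S _) (S _) = refl
  adjacent-sym (S _) (O _) = refl
  adjacent-sym (S _) (X _) = refl
  adjacent-sym (S _) (Y _) = refl
  adjacent-sym (O _) (S _) = refl
  adjacent-sym (O _) (O _) = refl
  adjacent-sym (O _) (X _) = refl
  adjacent-sym (O _) (Y _) = refl
  adjacent-sym (X _) (S _) = refl
  adjacent-sym (X _) (O _) = refl
  adjacent-sym (X x) (X y) = cong not (does-≟-sym x y)
  adjacent-sym (X _) (Y _) = refl
  adjacent-sym (Y _) (S _) = refl
  adjacent-sym (Y _) (O _) = refl
  adjacent-sym (Y _) (X _) = refl
  adjacent-sym (Y x) (Y y) = cong not (does-≟-sym x y)

  adjacent-irrefl : ∀ a → adjacent a a ≡ false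
  adjacent-irrefl (S _) = refl
  adjacent-irrefl (O _) = refl
  adjacent-irrefl (X x) = cong not (does-≟-refl x)
  adjacent-irrefl (Y y) = cong not (does-≟-refl y)

  gadget : Graph N
  gadget = record
    { adj    = λ u v → adjacent (dec u) (dec v)
    ; sym    = λ u v → adjacent-sym (dec u) (dec v)
    ; irrefl = λ v → adjacent-irrefl (dec v)
    }

  open Paths gadget

  adj-enc : ∀ a b → adj gadget (enc a) (enc b) ≡ adjacent a b
  adj-enc a b = cong₂ adjacent (dec-enc a) (dec-enc b)

  gadget-connected : Fin K → Fin k → Connected gadget
  gadget-connected i₀ j₀ = connected-via (enc (O j₀)) λ s → subst (λ v → Reachable v (enc (O j₀))) (enc-dec s) (to-hub (dec s))
    where
    link : ∀ a b → adjacent a b ≡ true → Reachable (enc a) (enc b)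
    link a b a~b = edge (trans (adj-enc a b) a~b)
    to-hub : ∀ a → Reachable (enc a) (enc (O j₀))
    to-hub (S i) = link (S i) (O j₀) refl
    to-hub (O j) = reachable-trans (link (O j) (S i₀) refl) (to-hub (S i₀))
    to-hub (X x) = reachable-trans (link (X x) (S (ox x)) (does-≟-refl (ox x))) (to-hub (S (ox x)))
    to-hub (Y y) = reachable-trans (link (Y y) (O (oy y)) (does-≟-refl (oy y)))
      (reachable-trans (link (O (oy y)) (S i₀) refl) (to-hub (S i₀)))

  -- An indexed family over `Node`: matching on a derivation enumerates all short walks between
  -- given kinds of nodes, and impossible edges disappear because `adjacent` computes to `false`.
  data Walk : ℕ → Node → Node → List Node → Set where
    stop : ∀ {a} → Walk 0 a a (a ∷ [])
    go   : ∀ {L a b c p} → adjacent a b ≡ true → Walk L b c p → Walk (suc L) a c (a ∷ p)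

  walk⁻ : ∀ L {a b p} → p ∈ walks gadget L (enc a) (enc b) → ∃ λ w → Walk L a b w × p ≡ map enc w
  walk⁻ zero {a} {b} p∈ with eq , refl ← walks-zero⁻ p∈ with refl ← enc-injective {a} {b} eq = a ∷ [] , stop , refl
  walk⁻ (suc L) {a} {b} p∈ with v , p′ , a~v , p′∈ , refl ← walks-suc⁻ {L} p∈
    with w , walk , refl ← walk⁻ L {dec v} {b} (subst (λ u → p′ ∈ walks gadget L u (enc b)) (sym (enc-dec v)) p′∈) =
    a ∷ w , go (trans (cong (λ z → adjacent z (dec v)) (sym (dec-enc a))) a~v) walk , refl

  walk⁺ : ∀ {L a b w} → Walk L a b w → map enc w ∈ walks gadget L (enc a) (enc b)
  walk⁺ stop = walks-zero⁺ _
  walk⁺ (go {L} {a} {b} a~b walk) = walks-suc⁺ {L = L} (trans (adj-enc a b) a~b) (walk⁺ walk)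

  no-walks : ∀ L a b → (∀ {w} → ¬ Walk L a b w) → walks gadget L (enc a) (enc b) ≡ []
  no-walks L a b none = no-members (λ p∈ → none (proj₁ (proj₂ (walk⁻ L p∈))))

  not-does : ∀ {n} {u v : Fin n} → u ≢ v → not (does (u ≟F v)) ≡ true
  not-does {u = u} {v} u≢v with u ≟F v
  ... | yes u≡v = contradiction u≡v u≢v
  ... | no  _   = refl

  walk-XX : ∀ {x x′ w} → Walk 1 (X x) (X x′) w → w ≡ X x ∷ X x′ ∷ []
  walk-XX (go _ stop) = refl

  walk-YY : ∀ {y y′ w} → Walk 1 (Y y) (Y y′) w → w ≡ Y y ∷ Y y′ ∷ []
  walk-YY (go _ stop) = refl

  no-walk-XY-0 : ∀ {x y w} → ¬ Walk 0 (X x) (Y y) w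
  no-walk-XY-0 ()

  no-walk-XY-1 : ∀ {x y w} → ¬ Walk 1 (X x) (Y y) w
  no-walk-XY-1 (go () stop)

  no-walk-XY-2 : ∀ {x y w} → ¬ Walk 2 (X x) (Y y) w
  no-walk-XY-2 (go {b = S _} _ (go () stop))
  no-walk-XY-2 (go {b = X _} _ (go () stop))

  -- Getting from X to Y takes an edge from pendant to S, one from S to O and one from O to pendant,
  -- so a walk of length 3 has no step to spare for a clique edge or a return. Each pendant
  -- determines its owner, hence the path is unique.
  walk-XY : ∀ {x y w} → Walk 3 (X x) (Y y) w → w ≡ X x ∷ S (ox x) ∷ O (oy y) ∷ Y y ∷ []
  walk-XY {x} {y} (go {b = S i} e₁ (go {b = O j} _ (go e₃ stop)))
    with refl ← does-≟⇒≡ {u = ox x} {i} e₁ | refl ← does-≟⇒≡ {u = oy y} {j} e₃ = refl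
  walk-XY (go {b = S i} e₁ (go {b = X _} _ (go () stop)))
  walk-XY (go {b = X _} e₁ (go {b = S _} _ (go () stop)))
  walk-XY (go {b = X _} e₁ (go {b = X _} _ (go () stop)))

  walk-XY-exists : ∀ x y → Walk 3 (X x) (Y y) (X x ∷ S (ox x) ∷ O (oy y) ∷ Y y ∷ [])
  walk-XY-exists x y = go (does-≟-refl (ox x)) (go refl (go (does-≟-refl (oy y)) stop))

  no-walk-YX-0 : ∀ {x y w} → ¬ Walk 0 (Y y) (X x) w
  no-walk-YX-0 ()

  no-walk-YX-1 : ∀ {x y w} → ¬ Walk 1 (Y y) (X x) w
  no-walk-YX-1 (go () stop)

  no-walk-YX-2 : ∀ {x y w} → ¬ Walk 2 (Y y) (X x) w
  no-walk-YX-2 (go {b = O _} _ (go () stop))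
  no-walk-YX-2 (go {b = Y _} _ (go () stop))

  walk-YX : ∀ {x y w} → Walk 3 (Y y) (X x) w → w ≡ Y y ∷ O (oy y) ∷ S (ox x) ∷ X x ∷ []
  walk-YX {x} {y} (go {b = O j} e₁ (go {b = S i} _ (go e₃ stop)))
    with refl ← does-≟⇒≡ {u = oy y} {j} e₁ | refl ← does-≟⇒≡ {u = ox x} {i} e₃ = refl
  walk-YX (go {b = O i} e₁ (go {b = Y _} _ (go () stop)))
  walk-YX (go {b = Y _} e₁ (go {b = O _} _ (go () stop)))
  walk-YX (go {b = Y _} e₁ (go {b = Y _} _ (go () stop)))

  walk-YX-exists : ∀ x y → Walk 3 (Y y) (X x) (Y y ∷ O (oy y) ∷ S (ox x) ∷ X x ∷ [])
  walk-YX-exists x y = go (does-≟-refl (oy y)) (go refl (go (does-≟-refl (ox x)) stop))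

  module _ (4≤N : 4 ℕ.≤ N) where

    2≤N : 2 ℕ.≤ N
    2≤N = ℕₚ.≤-trans (s≤s (s≤s z≤n)) 4≤N

    dist-XY : ∀ x y → dist gadget (enc (X x)) (enc (Y y)) ≡ 3
    dist-XY x y = dist≡3 4≤N (no-walks 0 (X x) (Y y) no-walk-XY-0) (no-walks 1 (X x) (Y y) no-walk-XY-1) (no-walks 2 (X x) (Y y) no-walk-XY-2)
      (member⇒≢[] (walk⁺ (walk-XY-exists x y)))

    dist-YX : ∀ x y → dist gadget (enc (Y y)) (enc (X x)) ≡ 3
    dist-YX x y = dist≡3 4≤N (no-walks 0 (Y y) (X x) no-walk-YX-0) (no-walks 1 (Y y) (X x) no-walk-YX-1) (no-walks 2 (Y y) (X x) no-walk-YX-2)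
      (member⇒≢[] (walk⁺ (walk-YX-exists x y)))

    dist-XX : ∀ {x x′} → x ≢ x′ → dist gadget (enc (X x)) (enc (X x′)) ≡ 1
    dist-XX {x} {x′} x≢x′ = dist≡1 2≤N (no-walks 0 (X x) (X x′) (λ { stop → x≢x′ refl }))
      (member⇒≢[] (walk⁺ (go {a = X x} {X x′} (not-does x≢x′) stop)))

    dist-YY : ∀ {y y′} → y ≢ y′ → dist gadget (enc (Y y)) (enc (Y y′)) ≡ 1
    dist-YY {y} {y′} y≢y′ = dist≡1 2≤N (no-walks 0 (Y y) (Y y′) (λ { stop → y≢y′ refl }))
      (member⇒≢[] (walk⁺ (go {a = Y y} {Y y′} (not-does y≢y′) stop)))

    shortest⁻ : ∀ {a b L p} → dist gadget (enc a) (enc b) ≡ L → p ∈ shortestPaths gadget (enc a) (enc b) →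
      ∃ λ w → Walk L a b w × p ≡ map enc w
    shortest⁻ {a} {b} {L} {p} d≡ p∈ = walk⁻ L (subst (λ d → p ∈ walks gadget d (enc a) (enc b)) d≡ p∈)

    shortest⁺ : ∀ {a b L w} → dist gadget (enc a) (enc b) ≡ L → Walk L a b w → shortestPaths gadget (enc a) (enc b) ≢ []
    shortest⁺ {a} {b} d≡ walk = subst (λ d → walks gadget d (enc a) (enc b) ≢ []) (sym d≡) (member⇒≢[] (walk⁺ walk))

    module _ (C : Subset N) where

      has : Node → Bool
      has a = lookup C (enc a)

      value : Node → Node → ℚ
      value a b = pairValue C (enc a) (enc b)

      -- A pair of an X and a Y avoids `C` at its two inner nodes exactly when both pendants are
      -- open. `touched` marks the endpoints whose pairs are written off as noise.
      isX isY openX openY touched : Node → ℕ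
      isX (X _) = 1
      isX _     = 0
      isY (Y _) = 1
      isY _     = 0
      openX (X x) = indicator (not (has (S (ox x))))
      openX _     = 0
      openY (Y y) = indicator (not (has (O (oy y))))
      openY _     = 0
      touched (S _) = 1
      touched (O _) = 1
      touched a     = indicator (has a)

      -- `GBC` ranges over ordered pairs, so each product is taken in both directions.
      cross : (f g : Node → ℕ) → Node → Node → ℕ
      cross f g a b = f a ℕ.* g b ℕ.+ g a ℕ.* f b

      cross-open-XX : ∀ x x′ → cross openX openY (X x) (X x′) ≡ 0
      cross-open-XX x x′ = trans (ℕₚ.+-identityʳ _) (ℕₚ.*-zeroʳ (openX (X x)))

      cross-open-YY : ∀ y y′ → cross openX openY (Y y) (Y y′) ≡ 0
      cross-open-YY y y′ = ℕₚ.*-zeroʳ (openY (Y y))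

      value-missed : ∀ {a b L} → dist gadget (enc a) (enc b) ≡ L →
        (∀ {w} → Walk L a b w → ¬ Hit C (map enc w)) → value a b ≤ 0ℚ
      value-missed {a} {b} d≡ missed = pairValue-missed C (enc a) (enc b)
        λ p∈ → case shortest⁻ {a} {b} d≡ p∈ of λ { (w , walk , refl) → missed walk }

      value-hit : ∀ {a b L w₀} → a ≢ b → dist gadget (enc a) (enc b) ≡ L → Walk L a b w₀ →
        (∀ {w} → Walk L a b w → Hit C (map enc w)) → 1ℚ ≤ value a b
      value-hit {a} {b} a≢b d≡ walk₀ hit = pairValue-hit C (enc a) (enc b) (a≢b ∘ enc-injective {a} {b}) (shortest⁺ d≡ walk₀)
        λ p∈ → case shortest⁻ {a} {b} d≡ p∈ of λ { (w , walk , refl) → hit walk }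

      value-same : ∀ a → value a a ≤ 0ℚ
      value-same a with enc a ≟F enc a
      ... | yes _ = ≤-refl
      ... | no ≢  = contradiction refl ≢

      0≤value : ∀ a b → 0ℚ ≤ value a b
      0≤value a b = 0≤pairValue C (enc a) (enc b)

      value≤1 : ∀ a b → value a b ≤ 1ℚ
      value≤1 a b = pairValue≤1 C (enc a) (enc b)

      ι≤value : ∀ a b m n → m ℕ.≤ n → ι m ≤ value a b + ι n
      ι≤value a b m n m≤n = ≤-trans (ι-mono-≤ m≤n) (subst (_≤ value a b + ι n) (+-identityˡ (ι n)) (+-monoˡ-≤ (ι n) (0≤value a b)))

      1≤value⇒ : ∀ a b n → 1ℚ ≤ value a b → ι 1 ≤ value a b + ι n
      1≤value⇒ a b n 1≤v = subst (_≤ value a b + ι n) (trans (+-identityʳ 1ℚ) (sym ι-1)) (+-mono-≤ 1≤v (0≤ι n))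

      -- A pair between X and Y with both pendants open is paid for by the correction term.
      -- Otherwise a chosen inner node lies on the only shortest path and the value is at least 1.
      -- All other pairs need only nonnegativity.
      lower : ∀ a b → ι (cross isX isY a b) ≤ value a b + ι (cross openX openY a b)
      lower (S i) b     = ι≤value (S i) b 0 0 z≤n
      lower (O j) b     = ι≤value (O j) b 0 0 z≤n
      lower (X x) (S i) = ι≤value (X x) (S i) 0 _ z≤n
      lower (X x) (O j) = ι≤value (X x) (O j) 0 _ z≤n
      lower (X x) (X z) = ι≤value (X x) (X z) 0 _ z≤n
      lower (Y y) (S i) = ι≤value (Y y) (S i) 0 _ z≤n
      lower (Y y) (O j) = ι≤value (Y y) (O j) 0 _ z≤n
      lower (Y y) (Y z) = ι≤value (Y y) (Y z) 0 _ z≤n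
      lower (X x) (Y y) with has (S (ox x)) in eqS | has (O (oy y)) in eqO
      ... | false | false = ι≤value (X x) (Y y) 1 1 ℕₚ.≤-refl
      ... | true  | _     = 1≤value⇒ (X x) (Y y) _ (value-hit (λ ()) (dist-XY x y) (walk-XY-exists x y)
        λ walk → subst (Hit C ∘ map enc) (sym (walk-XY walk)) (there (here eqS)))
      ... | false | true  = 1≤value⇒ (X x) (Y y) _ (value-hit (λ ()) (dist-XY x y) (walk-XY-exists x y)
        λ walk → subst (Hit C ∘ map enc) (sym (walk-XY walk)) (there (there (here eqO))))
      lower (Y y) (X x) with has (S (ox x)) in eqS | has (O (oy y)) in eqO
      ... | false | false = ι≤value (Y y) (X x) 1 1 ℕₚ.≤-refl
      ... | true  | _     = 1≤value⇒ (Y y) (X x) _ (value-hit (λ ()) (dist-YX x y) (walk-YX-exists x y)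
        λ walk → subst (Hit C ∘ map enc) (sym (walk-YX walk)) (there (there (here eqS))))
      ... | false | true  = 1≤value⇒ (Y y) (X x) _ (value-hit (λ ()) (dist-YX x y) (walk-YX-exists x y)
        λ walk → subst (Hit C ∘ map enc) (sym (walk-YX walk)) (there (here eqO)))

      value+≤ : ∀ a b m n → suc m ℕ.≤ n → value a b + ι m ≤ ι n
      value+≤ a b m n m<n = ≤-trans (+-monoˡ-≤ (ι m) (value≤1 a b))
        (≤-trans (≤-reflexive (trans (cong (_+ ι m) (sym ι-1)) (sym (ι-+ 1 m)))) (ι-mono-≤ m<n))

      0value+≤ : ∀ a b m n → value a b ≤ 0ℚ → m ℕ.≤ n → value a b + ι m ≤ ι n
      0value+≤ a b m n v≤0 m≤n = ≤-trans (+-monoˡ-≤ (ι m) v≤0) (≤-trans (≤-reflexive (+-identityˡ (ι m))) (ι-mono-≤ m≤n))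

      UpperBound : Node → Node → Set
      UpperBound a b = value a b + ι (cross openX openY a b) ≤ ι (cross isX isY a b ℕ.+ (touched a ℕ.+ touched b))

      missing : ∀ {a} → has a ≡ false → ¬ has a ≡ true
      missing eq eq′ with () ← trans (sym eq) eq′

      upper-XX : ∀ x z → UpperBound (X x) (X z)
      upper-XX x z rewrite cross-open-XX x z with has (X x) in eqx | has (X z) in eqz
      ... | true  | _     = value+≤ (X x) (X z) 0 _ (s≤s z≤n)
      ... | false | true  = value+≤ (X x) (X z) 0 _ (s≤s z≤n)
      ... | false | false with x ≟F z
      ...   | yes refl = 0value+≤ (X x) (X x) 0 0 (value-same (X x)) z≤n
      ...   | no x≢z   = 0value+≤ (X x) (X z) 0 0 (value-missed (dist-XX x≢z) λ walk →
        (λ { (here e) → missing {X x} eqx e ; (there (here e)) → missing {X z} eqz e }) ∘ subst (Hit C ∘ map enc) (walk-XX walk)) z≤n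

      upper-YY : ∀ y z → UpperBound (Y y) (Y z)
      upper-YY y z rewrite cross-open-YY y z with has (Y y) in eqy | has (Y z) in eqz
      ... | true  | _     = value+≤ (Y y) (Y z) 0 _ (s≤s z≤n)
      ... | false | true  = value+≤ (Y y) (Y z) 0 _ (s≤s z≤n)
      ... | false | false with y ≟F z
      ...   | yes refl = 0value+≤ (Y y) (Y y) 0 0 (value-same (Y y)) z≤n
      ...   | no y≢z   = 0value+≤ (Y y) (Y z) 0 0 (value-missed (dist-YY y≢z) λ walk →
        (λ { (here e) → missing {Y y} eqy e ; (there (here e)) → missing {Y z} eqz e }) ∘ subst (Hit C ∘ map enc) (walk-YY walk)) z≤n

      -- If an inner node is chosen, the single unit from `isX` and `isY` pays for the value. If
      -- both pendants are open, that unit pays for the correction term; then a chosen endpoint is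
      -- paid for by `touched`, and without one the only shortest path is missed.
      upper-XY : ∀ x y → UpperBound (X x) (Y y)
      upper-XY x y with has (S (ox x)) in eqS | has (O (oy y)) in eqO
      ... | true  | true  = value+≤ (X x) (Y y) 0 _ (s≤s z≤n)
      ... | true  | false = value+≤ (X x) (Y y) 0 _ (s≤s z≤n)
      ... | false | true  = value+≤ (X x) (Y y) 0 _ (s≤s z≤n)
      ... | false | false with has (X x) in eqx | has (Y y) in eqy
      ...   | true  | _     = value+≤ (X x) (Y y) 1 _ (s≤s (s≤s z≤n))
      ...   | false | true  = value+≤ (X x) (Y y) 1 _ (s≤s (s≤s z≤n))
      ...   | false | false = 0value+≤ (X x) (Y y) 1 1 (value-missed (dist-XY x y) λ walk →
        (λ { (here e) → missing {X x} eqx e ; (there (here e)) → missing {S (ox x)} eqS e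
           ; (there (there (here e))) → missing {O (oy y)} eqO e
           ; (there (there (there (here e)))) → missing {Y y} eqy e }) ∘ subst (Hit C ∘ map enc) (walk-XY walk)) (s≤s z≤n)

      upper-YX : ∀ x y → UpperBound (Y y) (X x)
      upper-YX x y with has (S (ox x)) in eqS | has (O (oy y)) in eqO
      ... | true  | true  = value+≤ (Y y) (X x) 0 _ (s≤s z≤n)
      ... | true  | false = value+≤ (Y y) (X x) 0 _ (s≤s z≤n)
      ... | false | true  = value+≤ (Y y) (X x) 0 _ (s≤s z≤n)
      ... | false | false with has (Y y) in eqy | has (X x) in eqx
      ...   | true  | _     = value+≤ (Y y) (X x) 1 _ (s≤s (s≤s z≤n))
      ...   | false | true  = value+≤ (Y y) (X x) 1 _ (s≤s (s≤s z≤n))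
      ...   | false | false = 0value+≤ (Y y) (X x) 1 1 (value-missed (dist-YX x y) λ walk →
        (λ { (here e) → missing {Y y} eqy e ; (there (here e)) → missing {O (oy y)} eqO e
           ; (there (there (here e))) → missing {S (ox x)} eqS e
           ; (there (there (there (here e)))) → missing {X x} eqx e }) ∘ subst (Hit C ∘ map enc) (walk-YX walk)) (s≤s z≤n)

      upper : ∀ a b → UpperBound a b
      upper (S i) b     = value+≤ (S i) b 0 _ (s≤s z≤n)
      upper (O j) b     = value+≤ (O j) b 0 _ (s≤s z≤n)
      upper (X x) (S i) rewrite ℕₚ.*-zeroʳ (openX (X x)) = value+≤ (X x) (S i) 0 _ (ℕₚ.m≤n+m 1 _)
      upper (X x) (O j) rewrite ℕₚ.*-zeroʳ (openX (X x)) = value+≤ (X x) (O j) 0 _ (ℕₚ.m≤n+m 1 _)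
      upper (Y y) (S i) rewrite ℕₚ.*-zeroʳ (openY (Y y)) = value+≤ (Y y) (S i) 0 _ (ℕₚ.m≤n+m 1 _)
      upper (Y y) (O j) rewrite ℕₚ.*-zeroʳ (openY (Y y)) = value+≤ (Y y) (O j) 0 _ (ℕₚ.m≤n+m 1 _)
      upper (X x) (X z) = upper-XX x z
      upper (Y y) (Y z) = upper-YY y z
      upper (X x) (Y y) = upper-XY x y
      upper (Y y) (X x) = upper-YX x y

      openXs openYs : ℕ
      openXs = sum (openX ∘ X)
      openYs = sum (openY ∘ Y)

      sum-isX : sum (isX ∘ dec) ≡ A
      sum-isX = trans (sum-dec isX) (trans (cong₂ ℕ._+_ (trans (sum-const K 0) (ℕₚ.*-zeroʳ K))
        (cong₂ ℕ._+_ (trans (sum-const k 0) (ℕₚ.*-zeroʳ k))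
        (cong₂ ℕ._+_ (trans (sum-const A 1) (ℕₚ.*-identityʳ A)) (trans (sum-const B 0) (ℕₚ.*-zeroʳ B)))))
        (ℕₚ.+-identityʳ A))

      sum-isY : sum (isY ∘ dec) ≡ B
      sum-isY = trans (sum-dec isY) (cong₂ ℕ._+_ (trans (sum-const K 0) (ℕₚ.*-zeroʳ K))
        (cong₂ ℕ._+_ (trans (sum-const k 0) (ℕₚ.*-zeroʳ k))
        (cong₂ ℕ._+_ (trans (sum-const A 0) (ℕₚ.*-zeroʳ A)) (trans (sum-const B 1) (ℕₚ.*-identityʳ B)))))

      sum-openX : sum (openX ∘ dec) ≡ openXs
      sum-openX = trans (sum-dec openX) (trans (cong₂ ℕ._+_ (trans (sum-const K 0) (ℕₚ.*-zeroʳ K))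
        (cong₂ ℕ._+_ (trans (sum-const k 0) (ℕₚ.*-zeroʳ k))
        (cong (openXs ℕ.+_) (trans (sum-const B 0) (ℕₚ.*-zeroʳ B)))))
        (ℕₚ.+-identityʳ openXs))

      sum-openY : sum (openY ∘ dec) ≡ openYs
      sum-openY = trans (sum-dec openY) (cong₂ ℕ._+_ (trans (sum-const K 0) (ℕₚ.*-zeroʳ K))
        (cong₂ ℕ._+_ (trans (sum-const k 0) (ℕₚ.*-zeroʳ k))
        (cong (ℕ._+ openYs) (trans (sum-const A 0) (ℕₚ.*-zeroʳ A)))))

      sum-has : sum (indicator ∘ has ∘ dec) ≡ ∣ C ∣
      sum-has = trans (sum-cong-≗ (λ v → cong (indicator ∘ lookup C) (enc-dec v))) (sum-indicator C)

      sum-touched : sum (touched ∘ dec) ℕ.≤ K ℕ.+ k ℕ.+ ∣ C ∣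
      sum-touched = begin
        sum (touched ∘ dec)
          ≡⟨ sum-dec touched ⟩
        sum {K} (λ _ → 1) ℕ.+ (sum {k} (λ _ → 1) ℕ.+ (hX ℕ.+ hY))
          ≡⟨ cong₂ (λ y z → y ℕ.+ (z ℕ.+ (hX ℕ.+ hY))) (trans (sum-const K 1) (ℕₚ.*-identityʳ K)) (trans (sum-const k 1) (ℕₚ.*-identityʳ k)) ⟩
        K ℕ.+ (k ℕ.+ (hX ℕ.+ hY))
          ≡⟨ sym (ℕₚ.+-assoc K k _) ⟩
        K ℕ.+ k ℕ.+ (hX ℕ.+ hY)
          ≤⟨ ℕₚ.+-monoʳ-≤ (K ℕ.+ k) (ℕₚ.≤-trans (ℕₚ.m≤n+m _ (sum (indicator ∘ has ∘ O))) (ℕₚ.m≤n+m _ (sum (indicator ∘ has ∘ S)))) ⟩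
        K ℕ.+ k ℕ.+ (sum (indicator ∘ has ∘ S) ℕ.+ (sum (indicator ∘ has ∘ O) ℕ.+ (hX ℕ.+ hY)))
          ≡⟨ cong (K ℕ.+ k ℕ.+_) (trans (sym (sum-dec (indicator ∘ has))) sum-has) ⟩
        K ℕ.+ k ℕ.+ ∣ C ∣ ∎
        where
        open ℕₚ.≤-Reasoning
        hX = sum (indicator ∘ has ∘ X)
        hY = sum (indicator ∘ has ∘ Y)

      sum-cross : ∀ f g → sum (λ s → sum (λ t → cross f g (dec s) (dec t))) ≡ 2 ℕ.* (sum (f ∘ dec) ℕ.* sum (g ∘ dec))
      sum-cross f g = begin
        sum (λ s → sum (λ t → f (dec s) ℕ.* g (dec t) ℕ.+ g (dec s) ℕ.* f (dec t)))
          ≡⟨ sum-cong-≗ (λ s → ∑-distrib-+ (λ t → f (dec s) ℕ.* g (dec t)) (λ t → g (dec s) ℕ.* f (dec t))) ⟩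
        sum (λ s → sum (λ t → f (dec s) ℕ.* g (dec t)) ℕ.+ sum (λ t → g (dec s) ℕ.* f (dec t)))
          ≡⟨ ∑-distrib-+ (λ s → sum (λ t → f (dec s) ℕ.* g (dec t))) (λ s → sum (λ t → g (dec s) ℕ.* f (dec t))) ⟩
        sum (λ s → sum (λ t → f (dec s) ℕ.* g (dec t))) ℕ.+ sum (λ s → sum (λ t → g (dec s) ℕ.* f (dec t)))
          ≡⟨ cong₂ ℕ._+_ (sum-product (f ∘ dec) (g ∘ dec)) (sum-product (g ∘ dec) (f ∘ dec)) ⟩
        F ℕ.* G ℕ.+ G ℕ.* F
          ≡⟨ cong (F ℕ.* G ℕ.+_) (trans (ℕₚ.*-comm G F) (sym (ℕₚ.+-identityʳ (F ℕ.* G)))) ⟩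
        2 ℕ.* (F ℕ.* G) ∎
        where
        open ≡-Reasoning
        F = sum (f ∘ dec)
        G = sum (g ∘ dec)

      sum-either : ∀ {n} (f : Fin n → ℕ) → sum (λ s → sum (λ t → f s ℕ.+ f t)) ≡ 2 ℕ.* (n ℕ.* sum f)
      sum-either {n} f = begin
        sum (λ s → sum (λ t → f s ℕ.+ f t))
          ≡⟨ sum-cong-≗ (λ s → trans (∑-distrib-+ (λ _ → f s) f) (cong (ℕ._+ sum f) (sum-const n (f s)))) ⟩
        sum (λ s → n ℕ.* f s ℕ.+ sum f)
          ≡⟨ ∑-distrib-+ (λ s → n ℕ.* f s) (λ _ → sum f) ⟩
        sum (λ s → n ℕ.* f s) ℕ.+ sum {n} (λ _ → sum f)
          ≡⟨ cong₂ ℕ._+_ (sym (*-distribˡ-sum n f)) (trans (sum-const n (sum f)) (sym (ℕₚ.+-identityʳ _))) ⟩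
        2 ℕ.* (n ℕ.* sum f) ∎
        where open ≡-Reasoning

      sum-cross-open : sum (λ s → sum (λ t → cross openX openY (dec s) (dec t))) ≡ 2 ℕ.* (openXs ℕ.* openYs)
      sum-cross-open = trans (sum-cross openX openY) (cong₂ (λ y z → 2 ℕ.* (y ℕ.* z)) sum-openX sum-openY)

      sum-cross-is : sum (λ s → sum (λ t → cross isX isY (dec s) (dec t))) ≡ 2 ℕ.* (A ℕ.* B)
      sum-cross-is = trans (sum-cross isX isY) (cong₂ (λ y z → 2 ℕ.* (y ℕ.* z)) sum-isX sum-isY)

      -- Together with `gadget-upper` this pins `GBC` to twice `A ℕ.* B` minus twice
      -- `openXs ℕ.* openYs`, up to an error of 2N times the bound in `sum-touched`. The error is
      -- linear in `N`, while the main term is a product of two cloud sizes.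
      gadget-lower : ι (2 ℕ.* (A ℕ.* B)) ≤ GBC gadget C + ι (2 ℕ.* (openXs ℕ.* openYs))
      gadget-lower = subst₂ (λ y z → ι y ≤ GBC gadget C + ι z) sum-cross-is sum-cross-open
        (GBC-lower C (λ s t → cross isX isY (dec s) (dec t)) (λ s t → cross openX openY (dec s) (dec t))
          (λ s t → subst₂ (λ u v → ι (cross isX isY (dec s) (dec t)) ≤ pairValue C u v + ι (cross openX openY (dec s) (dec t)))
            (enc-dec s) (enc-dec t) (lower (dec s) (dec t))))

      gadget-upper : GBC gadget C + ι (2 ℕ.* (openXs ℕ.* openYs)) ≤ ι (2 ℕ.* (A ℕ.* B) ℕ.+ 2 ℕ.* (N ℕ.* (K ℕ.+ k ℕ.+ ∣ C ∣)))
      gadget-upper = ≤-trans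
        (subst (λ z → GBC gadget C + ι z ≤ ι total) sum-cross-open
          (GBC-upper C pairBound (λ s t → cross openX openY (dec s) (dec t))
          (λ s t → subst₂ (λ u v → pairValue C u v + ι (cross openX openY (dec s) (dec t)) ≤ ι (pairBound s t))
            (enc-dec s) (enc-dec t) (upper (dec s) (dec t)))))
        (ι-mono-≤ (ℕₚ.≤-trans (ℕₚ.≤-reflexive total≡)
          (ℕₚ.+-monoʳ-≤ (2 ℕ.* (A ℕ.* B)) (ℕₚ.*-monoʳ-≤ 2 (ℕₚ.*-monoʳ-≤ N sum-touched)))))
        where
        pairBound : Fin N → Fin N → ℕ
        pairBound s t = cross isX isY (dec s) (dec t) ℕ.+ (touched (dec s) ℕ.+ touched (dec t))
        total : ℕ
        total = sum (λ s → sum (pairBound s))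
        total≡ : total ≡ 2 ℕ.* (A ℕ.* B) ℕ.+ 2 ℕ.* (N ℕ.* sum (touched ∘ dec))
        total≡ = trans (sum-cong-≗ (λ s → ∑-distrib-+ (λ t → cross isX isY (dec s) (dec t)) (λ t → touched (dec s) ℕ.+ touched (dec t))))
          (trans (∑-distrib-+ (λ s → sum (λ t → cross isX isY (dec s) (dec t))) (λ s → sum (λ t → touched (dec s) ℕ.+ touched (dec t))))
          (cong₂ ℕ._+_ sum-cross-is (sum-either (touched ∘ dec))))

-- Distributing pendants with prescribed multiplicities.

owner : ∀ {K} (a : Fin K → ℕ) → Fin (sum a) → Fin K
owner {suc K} a v = [ (λ _ → zero) , suc ∘ owner (a ∘ suc) ] (splitAt (a zero) v)

sum-owner : ∀ {K} (a : Fin K → ℕ) (h : Fin K → ℕ) → sum (h ∘ owner a) ≡ sum (λ i → a i ℕ.* h i)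
sum-owner {zero}  a h = refl
sum-owner {suc K} a h = trans (sum-↑ (a zero) (h ∘ owner a)) (cong₂ ℕ._+_
  (trans (sum-cong-≗ (λ v → cong (h ∘ [ (λ _ → zero) , suc ∘ owner (a ∘ suc) ]) (splitAt-↑ˡ (a zero) v (sum (a ∘ suc)))))
    (sum-const (a zero) (h zero)))
  (trans (sum-cong-≗ (λ v → cong (h ∘ [ (λ _ → zero) , suc ∘ owner (a ∘ suc) ]) (splitAt-↑ʳ (a zero) (sum (a ∘ suc)) v)))
    (sum-owner (a ∘ suc) (h ∘ suc))))

-- The greedy algorithm

maximizer : ∀ {A : Set} {P : A → Set} (P? : Decidable P) (f : A → ℚ) (xs : List A) → ∃ P →
  ∃ λ x → P x × (∀ y → y ∈ xs → P y → f y ≤ f x)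
maximizer P? f xs (x₀ , px₀) = argmax f x₀ (filter P? xs) , argmax-all f px₀ (all-filter P? xs) ,
  λ y y∈ py → All.lookup (f[xs]≤f[argmax] {f = f} x₀ (filter P? xs)) (∈-filter⁺ P? y∈ py)

∈-allSubsets : ∀ {n} (C : Subset n) → C ∈ allSubsets n
∈-allSubsets []      = here refl
∈-allSubsets (b ∷ C) = ∈-concatMap⁺ (λ p → (true ∷ p) ∷ (false ∷ p) ∷ []) (lose (∈-allSubsets C) (first b))
  where
  first : ∀ b → (b ∷ C) ∈ ((true ∷ C) ∷ (false ∷ C) ∷ [])
  first true  = here refl
  first false = there (here refl)

x∈p─q⇒x∉q : ∀ {n} {x : Fin n} (p q : Subset n) → x ∈ₛ p ─ q → x ∉ₛ q
x∈p─q⇒x∉q (_ ∷ p) (outside ∷ q) (there h) (there h′) = x∈p─q⇒x∉q p q h h′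
x∈p─q⇒x∉q (_ ∷ p) (inside  ∷ q) (there h) (there h′) = x∈p─q⇒x∉q p q h h′

∉⇒lookup≡false : ∀ {n} {v : Fin n} {C : Subset n} → v ∉ₛ C → lookup C v ≡ false
∉⇒lookup≡false {v = v} {C} v∉C with lookup C v in eq
... | true  = contradiction (lookup⇒[]= v C eq) v∉C
... | false = refl

lookup≡false⇒∉ : ∀ {n} {v : Fin n} {C : Subset n} → lookup C v ≡ false → v ∉ₛ C
lookup≡false⇒∉ eq v∈C with () ← trans (sym eq) ([]=⇒lookup v∈C)

lookup-insert-same : ∀ {n} (C : Subset n) v → lookup (C ∪ ⁅ v ⁆) v ≡ true
lookup-insert-same C v = []=⇒lookup (x∈p∪q⁺ {p = C} (inj₂ (x∈⁅x⁆ v)))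

lookup-insert-other : ∀ {n} (C : Subset n) {v w} → w ≢ v → lookup (C ∪ ⁅ v ⁆) w ≡ lookup C w
lookup-insert-other C {v} {w} w≢v with lookup C w in eq
... | true  = []=⇒lookup (x∈p∪q⁺ (inj₁ (lookup⇒[]= w C eq)))
... | false = ∉⇒lookup≡false λ w∈ → [ lookup≡false⇒∉ eq , w≢v ∘ x∈⁅y⁆⇒x≡y v ] (x∈p∪q⁻ C ⁅ v ⁆ w∈)

-- The additive form serves an increase and, with the two functions exchanged, a decrease: the first
-- gives the size after an insertion, the second the open weight.
sum-update : ∀ {n} (f g : Fin n → ℕ) c i → g i ≡ f i ℕ.+ c → (∀ j → j ≢ i → g j ≡ f j) → sum g ≡ sum f ℕ.+ c
sum-update {suc n} f g c zero    at off = begin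
  g zero ℕ.+ sum (g ∘ suc)         ≡⟨ cong₂ ℕ._+_ at (sum-cong-≗ (λ j → off (suc j) (λ ()))) ⟩
  (f zero ℕ.+ c) ℕ.+ sum (f ∘ suc) ≡⟨ ℕₚ.+-assoc (f zero) c _ ⟩
  f zero ℕ.+ (c ℕ.+ sum (f ∘ suc)) ≡⟨ cong (f zero ℕ.+_) (ℕₚ.+-comm c _) ⟩
  f zero ℕ.+ (sum (f ∘ suc) ℕ.+ c) ≡⟨ sym (ℕₚ.+-assoc (f zero) _ c) ⟩
  sum f ℕ.+ c                      ∎
  where open ≡-Reasoning
sum-update {suc n} f g c (suc i) at off = trans
  (cong₂ ℕ._+_ (off zero (λ ())) (sum-update (f ∘ suc) (g ∘ suc) c i at (λ j j≢i → off (suc j) (j≢i ∘ Finₚ.suc-injective))))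
  (sym (ℕₚ.+-assoc (f zero) _ c))

size-insert : ∀ {n} (C : Subset n) {v} → v ∉ₛ C → ∣ C ∪ ⁅ v ⁆ ∣ ≡ ∣ C ∣ ℕ.+ 1
size-insert C {v} v∉C = trans (sym (sum-indicator (C ∪ ⁅ v ⁆))) (trans
  (sum-update (indicator ∘ lookup C) (indicator ∘ lookup (C ∪ ⁅ v ⁆)) 1 v
    (trans (cong indicator (lookup-insert-same C v)) (sym (cong (λ b → indicator b ℕ.+ 1) (∉⇒lookup≡false v∉C))))
    (λ w w≢v → cong indicator (lookup-insert-other C w≢v)))
  (cong (ℕ._+ 1) (sum-indicator C)))

if-dec : ∀ {A P : Set} (Q : A → Set) (d : Dec P) {x y : A} → (P → Q x) → (¬ P → Q y) → Q (if does d then x else y)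
if-dec Q (yes p) f g = f p
if-dec Q (no ¬p) f g = g ¬p

insert-fits⇒< : ∀ {n m} (C : Subset n) {v} → v ∉ₛ C → ∣ C ∪ ⁅ v ⁆ ∣ ℕ.≤ m → ∣ C ∣ ℕ.< m
insert-fits⇒< {m = m} C v∉C = subst (ℕ._≤ m) (trans (size-insert C v∉C) (ℕₚ.+-comm ∣ C ∣ 1))

<⇒insert-fits : ∀ {n m} (C : Subset n) {v} → v ∉ₛ C → ∣ C ∣ ℕ.< m → ∣ C ∪ ⁅ v ⁆ ∣ ℕ.≤ m
<⇒insert-fits {m = m} C v∉C = subst (ℕ._≤ m) (sym (trans (size-insert C v∉C) (ℕₚ.+-comm ∣ C ∣ 1)))

-- For two sets of values `x` and `y` with missed amounts `r` and `s`, total `t` and noise `e`: a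
-- difference of the missed amounts that exceeds the noise decides the comparison.
<-from-gap : ∀ {x y} t e r s → s ℕ.+ e ℕ.< r → x + ι r ≤ ι (t ℕ.+ e) → ι t ≤ y + ι s → x < y
<-from-gap {x} {y} t e r s s+e<r upper lower = +-cancelʳ-< (begin-strict
  x + ι r           ≤⟨ upper ⟩
  ι (t ℕ.+ e)       ≡⟨ ι-+ t e ⟩
  ι t + ι e         ≤⟨ +-monoˡ-≤ (ι e) lower ⟩
  y + ι s + ι e     ≡⟨ +-assoc y (ι s) (ι e) ⟩
  y + (ι s + ι e)   ≡⟨ cong (λ z → y + z) (sym (ι-+ s e)) ⟩
  y + ι (s ℕ.+ e)   <⟨ +-monoʳ-< y (ι-mono-< s+e<r) ⟩
  y + ι r           ∎)
  where
  open ≤-Reasoning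
  +-cancelʳ-< : x + ι r < y + ι r → x < y
  +-cancelʳ-< h = subst₂ _<_ (cancel x) (cancel y) (+-monoˡ-< (- ι r) h)
    where
    cancel : ∀ z → z + ι r + - ι r ≡ z
    cancel z = trans (+-assoc z (ι r) (- ι r)) (trans (cong (λ w → z + w) (+-inverseʳ (ι r))) (+-identityʳ z))

nodeCount : ∀ {K} → ℕ → (Fin K → ℕ) → ℕ → ℕ
nodeCount {K} k a b = K ℕ.+ (k ℕ.+ (sum a ℕ.+ sum {k} (λ _ → b)))

-- At most K + k + k nodes are an S, an O or chosen.
noiseBound : ∀ {K} → ℕ → (Fin K → ℕ) → ℕ → ℕ
noiseBound {K} k a b = nodeCount k a b ℕ.* (K ℕ.+ k ℕ.+ k)

-- The hypotheses isolate what the weights must provide. `largeGap` finds an unchosen S with at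
-- least 1/p of the open weight, `noise<ba` keeps the noise below the margin of one comparison, and
-- `remainder` bounds what at most `k` of the S's leave open. The 4 in `k≡4+p` stands for three O's
-- from the seed and the one under consideration, after which at least `p` are still open.
module GreedyOnGadget
  {K : ℕ} (k p : ℕ) (k≡4+p : k ≡ 4 ℕ.+ p) (a : Fin K → ℕ) (b : ℕ)
  (4≤nodes : 4 ℕ.≤ nodeCount k a b)
  (noise<ba : ∀ i → noiseBound k a b ℕ.< b ℕ.* a i)
  (largeGap : ∀ (P : Fin K → Bool) → sum (indicator ∘ P) ℕ.< k →
    ∃ λ i → P i ≡ false × sum (λ i → a i ℕ.* indicator (not (P i))) ℕ.≤ p ℕ.* a i)
  (r : ℕ)
  (remainder : ∀ (P : Fin K → Bool) → sum (indicator ∘ P) ℕ.≤ k → r ℕ.≤ sum (λ i → a i ℕ.* indicator (not (P i))))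
  where

  open Gadget (owner a) (owner {k} (λ _ → b)) public

  noise : ℕ
  noise = noiseBound k a b

  private
    hasS : Subset N → Fin K → Bool
    hasS C i = lookup C (enc (S i))

    hasO : Subset N → Fin k → Bool
    hasO C j = lookup C (enc (O j))

    openWeight openOs chosenOs : Subset N → ℕ
    openWeight C = sum (λ i → a i ℕ.* indicator (not (hasS C i)))
    openOs     C = sum (indicator ∘ not ∘ hasO C)
    chosenOs   C = sum (indicator ∘ hasO C)

    openXs≡ : ∀ C → openXs 4≤nodes C ≡ openWeight C
    openXs≡ C = sum-owner a (λ i → indicator (not (hasS C i)))

    openYs≡ : ∀ C → openYs 4≤nodes C ≡ b ℕ.* openOs C
    openYs≡ C = trans (sum-owner {k} (λ _ → b) (λ j → indicator (not (hasO C j)))) (sym (*-distribˡ-sum b (λ j → indicator (not (hasO C j)))))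

    total : ℕ
    total = 2 ℕ.* (sum a ℕ.* sum {k} (λ _ → b))

    missed : Subset N → ℕ
    missed C = 2 ℕ.* (openWeight C ℕ.* (b ℕ.* openOs C))

    missed≡ : ∀ C → 2 ℕ.* (openXs 4≤nodes C ℕ.* openYs 4≤nodes C) ≡ missed C
    missed≡ C = cong₂ (λ y z → 2 ℕ.* (y ℕ.* z)) (openXs≡ C) (openYs≡ C)

    GBC-≥ : ∀ C → ι total ≤ GBC gadget C + ι (missed C)
    GBC-≥ C = subst (λ z → ι total ≤ GBC gadget C + ι z) (missed≡ C) (gadget-lower 4≤nodes C)

    GBC-≤ : ∀ C → ∣ C ∣ ℕ.≤ k → GBC gadget C + ι (missed C) ≤ ι (total ℕ.+ 2 ℕ.* noise)
    GBC-≤ C ∣C∣≤k = ≤-trans (subst (λ z → GBC gadget C + ι z ≤ ι (total ℕ.+ 2 ℕ.* (N ℕ.* (K ℕ.+ k ℕ.+ ∣ C ∣)))) (missed≡ C) (gadget-upper 4≤nodes C))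
      (ι-mono-≤ (ℕₚ.+-monoʳ-≤ total (ℕₚ.*-monoʳ-≤ 2 (ℕₚ.*-monoʳ-≤ N (ℕₚ.+-monoʳ-≤ (K ℕ.+ k) ∣C∣≤k)))))

    openOs+chosenOs : ∀ C → openOs C ℕ.+ chosenOs C ≡ k
    openOs+chosenOs C = sum-indicator-not (hasO C)

    sizeSplit : ∀ C → sum (indicator ∘ hasS C) ℕ.+ chosenOs C ℕ.≤ ∣ C ∣
    sizeSplit C = begin
      sum (indicator ∘ hasS C) ℕ.+ chosenOs C
        ≤⟨ ℕₚ.+-monoʳ-≤ (sum (indicator ∘ hasS C)) (ℕₚ.m≤m+n (chosenOs C) _) ⟩
      sum (indicator ∘ hasS C) ℕ.+ (chosenOs C ℕ.+ (sum (indicator ∘ has 4≤nodes C ∘ X) ℕ.+ sum (indicator ∘ has 4≤nodes C ∘ Y)))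
        ≡⟨ sym (sum-dec (indicator ∘ has 4≤nodes C)) ⟩
      sum (indicator ∘ has 4≤nodes C ∘ dec)
        ≡⟨ sum-has 4≤nodes C ⟩
      ∣ C ∣ ∎
      where open ℕₚ.≤-Reasoning

    chosenS≤size : ∀ C → sum (indicator ∘ hasS C) ℕ.≤ ∣ C ∣
    chosenS≤size C = ℕₚ.≤-trans (ℕₚ.m≤m+n _ (chosenOs C)) (sizeSplit C)

    chosenOs≤size : ∀ C → chosenOs C ℕ.≤ ∣ C ∣
    chosenOs≤size C = ℕₚ.≤-trans (ℕₚ.m≤n+m (chosenOs C) _) (sizeSplit C)

    FewOs : Subset N → Set
    FewOs C = ∣ C ∣ ℕ.≤ k × chosenOs C ℕ.≤ 3

    p<openOs : ∀ C → chosenOs C ℕ.≤ 3 → suc p ℕ.≤ openOs C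
    p<openOs C chosen≤3 = ℕₚ.+-cancelʳ-≤ 3 (suc p) (openOs C) (begin
      suc p ℕ.+ 3                ≡⟨ ℕₚ.+-comm (suc p) 3 ⟩
      3 ℕ.+ suc p                ≡⟨ ℕₚ.+-suc 3 p ⟩
      4 ℕ.+ p                    ≡⟨ sym k≡4+p ⟩
      k                          ≡⟨ sym (openOs+chosenOs C) ⟩
      openOs C ℕ.+ chosenOs C    ≤⟨ ℕₚ.+-monoʳ-≤ (openOs C) chosen≤3 ⟩
      openOs C ℕ.+ 3             ∎)
      where open ℕₚ.≤-Reasoning

    insert : Subset N → Node → Subset N
    insert C v = C ∪ ⁅ enc v ⁆

    unaffected : ∀ C v w → w ≢ v → lookup (insert C v) (enc w) ≡ lookup C (enc w)
    unaffected C v w w≢v = lookup-insert-other C (w≢v ∘ enc-injective {w} {v})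

    -- With u the open weight and z the number of unchosen O's, adding S i lowers the product
    -- b u z to b (u - a i) z, and adding O j lowers it to b u (z - 1).
    beats : ∀ C j → ∣ C ∣ ℕ.< k → chosenOs C ℕ.≤ 3 → enc (O j) ∉ₛ C →
      ∃ λ i → enc (S i) ∉ₛ C × GBC gadget (insert C (O j)) < GBC gadget (insert C (S i))
    beats C j ∣C∣<k few Oj∉C with largeGap (hasS C) (ℕₚ.≤-<-trans (chosenS≤size C) ∣C∣<k)
    ... | i , Si-open , u≤pa = i , lookup≡false⇒∉ Si-open ,
      <-from-gap total (2 ℕ.* noise) (missed (insert C (O j))) (missed (insert C (S i))) gap
        (GBC-≤ (insert C (O j)) (<⇒insert-fits C Oj∉C ∣C∣<k))
        (GBC-≥ (insert C (S i)))
      where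
      u  = openWeight C
      u′ = openWeight (insert C (S i))
      z  = openOs C
      z′ = openOs (insert C (O j))
      u≡ : u ≡ u′ ℕ.+ a i
      u≡ = sum-update _ _ (a i) i
        (trans (trans (cong (λ c → a i ℕ.* indicator (not c)) Si-open) (ℕₚ.*-identityʳ (a i)))
          (sym (cong (ℕ._+ a i) (trans (cong (λ c → a i ℕ.* indicator (not c)) (lookup-insert-same C (enc (S i)))) (ℕₚ.*-zeroʳ (a i))))))
        (λ i′ i′≢i → cong (λ c → a i′ ℕ.* indicator (not c)) (sym (unaffected C (S i) (S i′) (λ { refl → i′≢i refl }))))
      z≡ : z ≡ z′ ℕ.+ 1
      z≡ = sum-update _ _ 1 j
        (trans (cong (indicator ∘ not) (∉⇒lookup≡false Oj∉C))
          (sym (cong (λ c → indicator (not c) ℕ.+ 1) (lookup-insert-same C (enc (O j))))))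
        (λ j′ j′≢j → cong (indicator ∘ not) (sym (unaffected C (O j) (O j′) (λ { refl → j′≢j refl }))))
      u-after-O : openWeight (insert C (O j)) ≡ u
      u-after-O = sum-cong-≗ (λ i′ → cong (λ c → a i′ ℕ.* indicator (not c)) (unaffected C (O j) (S i′) (λ ())))
      z-after-S : openOs (insert C (S i)) ≡ z
      z-after-S = sum-cong-≗ (λ j′ → cong (indicator ∘ not) (unaffected C (S i) (O j′) (λ ())))
      p≤z′ : p ℕ.≤ z′
      p≤z′ = ℕₚ.≤-pred (ℕₚ.≤-trans (p<openOs C few) (ℕₚ.≤-reflexive (trans z≡ (ℕₚ.+-comm z′ 1))))
      -- The noise is replaced by `b ℕ.* a i`, which completes `b ℕ.* u′` to `b ℕ.* u`. By
      -- `largeGap` and `p≤z′` the latter is at most `b ℕ.* (z′ ℕ.* a i)`.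
      core : u′ ℕ.* (b ℕ.* z) ℕ.+ noise ℕ.< u ℕ.* (b ℕ.* z′)
      core = begin-strict
        u′ ℕ.* (b ℕ.* z) ℕ.+ noise
          ≡⟨ cong (λ y → u′ ℕ.* (b ℕ.* y) ℕ.+ noise) z≡ ⟩
        u′ ℕ.* (b ℕ.* (z′ ℕ.+ 1)) ℕ.+ noise
          <⟨ ℕₚ.+-monoʳ-< (u′ ℕ.* (b ℕ.* (z′ ℕ.+ 1))) (noise<ba i) ⟩
        u′ ℕ.* (b ℕ.* (z′ ℕ.+ 1)) ℕ.+ b ℕ.* a i
          ≡⟨ solve 4 (λ u b z a → u :* (b :* (z :+ con 1)) :+ b :* a := u :* (b :* z) :+ b :* (u :+ a)) refl u′ b z′ (a i) ⟩
        u′ ℕ.* (b ℕ.* z′) ℕ.+ b ℕ.* (u′ ℕ.+ a i)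
          ≡⟨ cong (λ y → u′ ℕ.* (b ℕ.* z′) ℕ.+ b ℕ.* y) (sym u≡) ⟩
        u′ ℕ.* (b ℕ.* z′) ℕ.+ b ℕ.* u
          ≤⟨ ℕₚ.+-monoʳ-≤ (u′ ℕ.* (b ℕ.* z′)) (ℕₚ.*-monoʳ-≤ b (ℕₚ.≤-trans u≤pa (ℕₚ.*-monoˡ-≤ (a i) p≤z′))) ⟩
        u′ ℕ.* (b ℕ.* z′) ℕ.+ b ℕ.* (z′ ℕ.* a i)
          ≡⟨ solve 4 (λ u b z a → u :* (b :* z) :+ b :* (z :* a) := (u :+ a) :* (b :* z)) refl u′ b z′ (a i) ⟩
        (u′ ℕ.+ a i) ℕ.* (b ℕ.* z′)
          ≡⟨ cong (ℕ._* (b ℕ.* z′)) (sym u≡) ⟩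
        u ℕ.* (b ℕ.* z′) ∎
        where
        open ℕₚ.≤-Reasoning
        open Data.Nat.Solver.+-*-Solver
      gap : missed (insert C (S i)) ℕ.+ 2 ℕ.* noise ℕ.< missed (insert C (O j))
      gap = subst₂ ℕ._<_
        (trans (ℕₚ.*-distribˡ-+ 2 (u′ ℕ.* (b ℕ.* z)) noise) (cong (λ y → 2 ℕ.* (u′ ℕ.* (b ℕ.* y)) ℕ.+ 2 ℕ.* noise) (sym z-after-S)))
        (cong (λ y → 2 ℕ.* (y ℕ.* (b ℕ.* z′))) (sym u-after-O))
        (ℕₚ.*-monoʳ-< 2 core)

    -- `complete` is claimed only below the budget: a node leaves `U` without entering `C` only if
    -- it does not fit, and then `C` is already full. `disjoint` makes every candidate new, so an
    -- insertion raises the size by exactly one.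
    record Invariant (C U : Subset N) : Set where
      field
        disjoint : ∀ {v} → v ∈ₛ U → v ∉ₛ C
        complete : ∣ C ∣ ℕ.< k → ∀ {v} → v ∉ₛ C → v ∈ₛ U
        fewOs    : FewOs C
    open Invariant

    chosenOs-after : ∀ C v → (∀ j → v ≢ O j) → chosenOs (insert C v) ≡ chosenOs C
    chosenOs-after C v v≢O = sum-cong-≗ (λ j → cong indicator (unaffected C v (O j) (λ eq → v≢O j (sym eq))))

    -- Only the case of an O needs work. If it still fits, `C` is below the budget, so `complete`
    -- places the better S found by `beats` in `U`, and the O is not a maximizer.
    fewOs-step : ∀ {C U} → Invariant C U → ∀ v → enc v ∈ₛ U →
      (∀ w → w ∈ₛ U → gain gadget k C w ≤ gain gadget k C (enc v)) →
      ∣ insert C v ∣ ℕ.≤ k → chosenOs (insert C v) ℕ.≤ 3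
    fewOs-step {C} inv (S i) v∈U best fits = subst (ℕ._≤ 3) (sym (chosenOs-after C (S i) (λ _ ()))) (proj₂ (fewOs inv))
    fewOs-step {C} inv (X x) v∈U best fits = subst (ℕ._≤ 3) (sym (chosenOs-after C (X x) (λ _ ()))) (proj₂ (fewOs inv))
    fewOs-step {C} inv (Y y) v∈U best fits = subst (ℕ._≤ 3) (sym (chosenOs-after C (Y y) (λ _ ()))) (proj₂ (fewOs inv))
    fewOs-step {C} inv (O j) v∈U best fits = contradiction best′ (worse (beats C j ∣C∣<k (proj₂ (fewOs inv)) (disjoint inv v∈U)))
      where
      ∣C∣<k : ∣ C ∣ ℕ.< k
      ∣C∣<k = insert-fits⇒< C (disjoint inv v∈U) fits
      best′ : ∀ i → enc (S i) ∉ₛ C → gain gadget k C (enc (S i)) ≤ gain gadget k C (enc (O j))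
      best′ i Si∉C = best (enc (S i)) (complete inv ∣C∣<k Si∉C)
      worse : (∃ λ i → enc (S i) ∉ₛ C × GBC gadget (insert C (O j)) < GBC gadget (insert C (S i))) →
        ¬ (∀ i → enc (S i) ∉ₛ C → gain gadget k C (enc (S i)) ≤ gain gadget k C (enc (O j)))
      worse (i , Si∉C , less) best′ = <-irrefl refl (<-≤-trans (+-monoˡ-< (- GBC gadget C) less) (best′ i Si∉C))

    invariant-step : ∀ {C U} → Invariant C U → ∀ v → v ∈ₛ U →
      (∀ w → w ∈ₛ U → gain gadget k C w ≤ gain gadget k C v) →
      Invariant (if does (∣ C ∪ ⁅ v ⁆ ∣ ℕₚ.≤? k) then C ∪ ⁅ v ⁆ else C) (U ∖ v)
    invariant-step {C} {U} inv v v∈U best = if-dec (λ C′ → Invariant C′ (U ∖ v)) (∣ C ∪ ⁅ v ⁆ ∣ ℕₚ.≤? k)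
     (λ fits → record
      { disjoint = λ {w} w∈ w∈C∪v → [ disjoint inv (p─q⊆p U ⁅ v ⁆ w∈) , x∈p─q⇒x∉q U ⁅ v ⁆ w∈ ] (x∈p∪q⁻ C ⁅ v ⁆ w∈C∪v)
      ; complete = λ _ {w} w∉ → x∈p∧x≢y⇒x∈p-y
          (complete inv (insert-fits⇒< C (disjoint inv v∈U) fits) (w∉ ∘ x∈p∪q⁺ ∘ inj₁))
          (λ { refl → w∉ (x∈p∪q⁺ {p = C} (inj₂ (x∈⁅x⁆ v))) })
      ; fewOs = fits , subst (λ w → chosenOs (C ∪ ⁅ w ⁆) ℕ.≤ 3) (enc-dec v)
          (fewOs-step inv (dec v) (subst (_∈ₛ U) (sym (enc-dec v)) v∈U)
            (subst (λ u → ∀ w → w ∈ₛ U → gain gadget k C w ≤ gain gadget k C u) (sym (enc-dec v)) best)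
            (subst (λ w → ∣ C ∪ ⁅ w ⁆ ∣ ℕ.≤ k) (sym (enc-dec v)) fits))
      })
     (λ ¬fits → record
      { disjoint = disjoint inv ∘ p─q⊆p U ⁅ v ⁆
      ; complete = λ ∣C∣<k → contradiction
          (<⇒insert-fits C (disjoint inv v∈U) ∣C∣<k) ¬fits
      ; fewOs = fewOs inv
      })

    GreedyRun : Subset N → Subset N → Set
    GreedyRun C U = ∃ λ C′ → GreedyLoop gadget k C U C′ × FewOs C′

    -- `m` bounds the size of `U`, which drops with each pick, and drives the recursion. Any
    -- maximizer may be taken, since `invariant-step` holds for each of them.
    greedyLoop : ∀ m {C U} → ∣ U ∣ ℕ.≤ m → Invariant C U → GreedyRun C U
    pick : ∀ m {C U} → ∣ U ∣ ℕ.≤ m → Invariant C U →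
      (∃ λ v → v ∈ₛ U × (∀ w → w ∈ allFin N → w ∈ₛ U → gain gadget k C w ≤ gain gadget k C v)) → GreedyRun C U

    greedyLoop m {C} {U} ∣U∣≤m inv with nonempty? U
    ... | no empty     = C , done empty , fewOs inv
    ... | yes nonempty = pick m ∣U∣≤m inv (maximizer (_∈? U) (gain gadget k C) (allFin N) nonempty)

    pick zero    ∣U∣≤0 inv (v , v∈U , best) = contradiction (ℕₚ.<-≤-trans (x∈p⇒∣p-x∣<∣p∣ v∈U) ∣U∣≤0) λ ()
    pick (suc m) ∣U∣≤m inv (v , v∈U , best) = prepend
      (greedyLoop m (ℕₚ.≤-pred (ℕₚ.<-≤-trans (x∈p⇒∣p-x∣<∣p∣ v∈U) ∣U∣≤m))
        (invariant-step inv v v∈U (λ w → best w (∈-allFin w))))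
      where
      prepend : GreedyRun _ _ → GreedyRun _ _
      prepend (C′ , loop , few) = C′ , step v v∈U (λ w → best w (∈-allFin w)) loop , few

    choose : ∀ d {C H} → FewOs C → FewOs H → FewOs (if d then C else H)
    choose true  few _ = few
    choose false _ few = few

    OuterRun : Subset N → List (Subset N) → Set
    OuterRun H Cs = ∃ λ H′ → OuterLoop gadget k H Cs H′ × FewOs H′

    outerLoop : ∀ Cs H → FewOs H → OuterRun H Cs
    visitSeed : ∀ {C₀} Cs {H} → FewOs H → ∣ C₀ ∣ ℕ.≤ 3 → ∣ C₀ ∣ ℕ.≤ k → GreedyRun C₀ (∁ C₀) → OuterRun H (C₀ ∷ Cs)
    skipSeed : ∀ {C₀ H Cs} → (does (∣ C₀ ∣ ℕ.≤? 3) Bool.∧ does (∣ C₀ ∣ ℕ.≤? k)) ≡ false → OuterRun H Cs → OuterRun H (C₀ ∷ Cs)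

    outerLoop []        H fewH = H , finish , fewH
    outerLoop (C₀ ∷ Cs) H fewH = decide (∣ C₀ ∣ ℕ.≤? 3) (∣ C₀ ∣ ℕ.≤? k) refl refl
      where
      decide : (d₃ : Dec (∣ C₀ ∣ ℕ.≤ 3)) (dₖ : Dec (∣ C₀ ∣ ℕ.≤ k)) →
        does (∣ C₀ ∣ ℕ.≤? 3) ≡ does d₃ → does (∣ C₀ ∣ ℕ.≤? k) ≡ does dₖ → OuterRun H (C₀ ∷ Cs)
      decide (no _)   _        eq₃ eqₖ = skipSeed (cong (Bool._∧ does (∣ C₀ ∣ ℕ.≤? k)) eq₃) (outerLoop Cs H fewH)
      decide (yes _)  (no _)   eq₃ eqₖ = skipSeed (cong₂ Bool._∧_ eq₃ eqₖ) (outerLoop Cs H fewH)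
      -- Here the bound 3 enters: a seed has at most three nodes and hence at most three O's.
      decide (yes ≤3) (yes ≤k) _   _   = visitSeed Cs fewH ≤3 ≤k (greedyLoop _ ℕₚ.≤-refl (record
        { disjoint = x∈∁p⇒x∉p ; complete = λ _ → x∉p⇒x∈∁p ; fewOs = ≤k , ℕₚ.≤-trans (chosenOs≤size C₀) ≤3 }))

    visitSeed {C₀} Cs {H} fewH ≤3 ≤k (C , run , fewC) =
      prepend (outerLoop Cs _ (choose (does (GBC gadget H ℚ.<? GBC gadget C)) fewC fewH))
      where
      prepend : OuterRun (if does (GBC gadget H ℚ.<? GBC gadget C) then C else H) Cs → OuterRun H (C₀ ∷ Cs)
      prepend (H′ , loop , few) = H′ , visit ≤3 ≤k run loop , few

    skipSeed eq (H′ , loop , few) = H′ , skip eq loop , few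

    ∣⊥∣≤ : ∀ m → ∣ ⊥ {N} ∣ ℕ.≤ m
    ∣⊥∣≤ m = subst (ℕ._≤ m) (sym (∣⊥∣≡0 N)) z≤n

  -- The output leaves S-weight at least `r` open by `remainder` and, having at most three O's, at
  -- least `suc p` O's open. Its value falls short of the total by the pairs between these two open
  -- sides, up to noise.
  greedy-output : ∃ λ H → GreedyOutput gadget k H ×
    GBC gadget H + ι (2 ℕ.* (r ℕ.* (b ℕ.* suc p))) ≤ ι (2 ℕ.* (sum a ℕ.* sum {k} (λ _ → b)) ℕ.+ 2 ℕ.* noise)
  greedy-output = bound (outerLoop (allSubsets N) ⊥ (∣⊥∣≤ k , ℕₚ.≤-trans (chosenOs≤size ⊥) (∣⊥∣≤ 3)))
    where
    bound : OuterRun ⊥ (allSubsets N) → ∃ λ H → GreedyOutput gadget k H ×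
      GBC gadget H + ι (2 ℕ.* (r ℕ.* (b ℕ.* suc p))) ≤ ι (total ℕ.+ 2 ℕ.* noise)
    bound (H , output , ∣H∣≤k , few) = H , output , ≤-trans
      (+-monoʳ-≤ (GBC gadget H) (ι-mono-≤ (ℕₚ.*-monoʳ-≤ 2 (ℕₚ.*-mono-≤
        (remainder (hasS H) (ℕₚ.≤-trans (chosenS≤size H) ∣H∣≤k)) (ℕₚ.*-monoʳ-≤ b (p<openOs H few))))))
      (GBC-≤ H ∣H∣≤k)

  -- Comparison of the optimum with the set of all O's.

  private
    isO : Node → Bool
    isO (O _) = true
    isO _     = false

    allOs : Subset N
    allOs = Vec.tabulate (isO ∘ dec)

    ∣allOs∣≡k : ∣ allOs ∣ ≡ k
    ∣allOs∣≡k = trans (sym (sum-indicator allOs)) (trans (sum-cong-≗ (λ v → cong indicator (lookup∘tabulate (isO ∘ dec) v)))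
      (trans (sum-dec (indicator ∘ isO)) (trans (cong₂ ℕ._+_ (trans (sum-const K 0) (ℕₚ.*-zeroʳ K))
        (cong₂ ℕ._+_ (trans (sum-const k 1) (ℕₚ.*-identityʳ k))
        (cong₂ ℕ._+_ (trans (sum-const (sum a) 0) (ℕₚ.*-zeroʳ (sum a)))
                     (trans (sum-const (sum {k} (λ _ → b)) 0) (ℕₚ.*-zeroʳ (sum {k} (λ _ → b)))))))
        (ℕₚ.+-identityʳ k))))

    missed-allOs : missed allOs ≡ 0
    missed-allOs = trans (cong (λ z → 2 ℕ.* (openWeight allOs ℕ.* (b ℕ.* z))) openOs≡0)
      (trans (cong (λ z → 2 ℕ.* (openWeight allOs ℕ.* z)) (ℕₚ.*-zeroʳ b)) (cong (2 ℕ.*_) (ℕₚ.*-zeroʳ (openWeight allOs))))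
      where
      openOs≡0 : openOs allOs ≡ 0
      openOs≡0 = trans (sum-cong-≗ (λ j → cong (indicator ∘ not)
        (trans (lookup∘tabulate (isO ∘ dec) (enc (O j))) (cong isO (dec-enc (O j)))))) (trans (sum-const k 0) (ℕₚ.*-zeroʳ k))

  -- A maximizer comes from a search through the finite list of subsets. Its value is at least that
  -- of `allOs`, which leaves no O open and so misses no pair between X and Y.
  optimum : ∃ λ Copt → ∣ Copt ∣ ℕ.≤ k × (∀ C → ∣ C ∣ ℕ.≤ k → GBC gadget C ≤ GBC gadget Copt) ×
    ι (2 ℕ.* (sum a ℕ.* sum {k} (λ _ → b))) ≤ GBC gadget Copt
  optimum = bound (maximizer (λ C → ∣ C ∣ ℕₚ.≤? k) (GBC gadget) (allSubsets N) (allOs , ℕₚ.≤-reflexive ∣allOs∣≡k))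
    where
    bound : (∃ λ Copt → ∣ Copt ∣ ℕ.≤ k × (∀ C → C ∈ allSubsets N → ∣ C ∣ ℕ.≤ k → GBC gadget C ≤ GBC gadget Copt)) →
      ∃ λ Copt → ∣ Copt ∣ ℕ.≤ k × (∀ C → ∣ C ∣ ℕ.≤ k → GBC gadget C ≤ GBC gadget Copt) × ι total ≤ GBC gadget Copt
    bound (Copt , ∣Copt∣≤k , best) = Copt , ∣Copt∣≤k , (λ C → best C (∈-allSubsets C)) ,
      ≤-trans (subst (ι total ≤_) (trans (cong (λ z → GBC gadget allOs + ι z) missed-allOs)
          (trans (cong (λ z → GBC gadget allOs + z) ι-0) (+-identityʳ (GBC gadget allOs)))) (GBC-≥ allOs))
        (best allOs (∈-allSubsets allOs) (ℕₚ.≤-reflexive ∣allOs∣≡k))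

-- Geometric weights

sum-mono-≤ : ∀ {n} (f g : Fin n → ℕ) → (∀ i → f i ℕ.≤ g i) → sum f ℕ.≤ sum g
sum-mono-≤ {zero}  f g h = z≤n
sum-mono-≤ {suc n} f g h = ℕₚ.+-mono-≤ (h zero) (sum-mono-≤ (f ∘ suc) (g ∘ suc) (h ∘ suc))

-- The first l weights decrease geometrically, each being 1/(q+1) of the weight from it onwards;
-- the last q weights are equal.
weight : ∀ q l → ℕ → Fin (l ℕ.+ q) → ℕ
weight q zero    e _       = e
weight q (suc l) e zero    = q ℕ.* e ℕ.* suc q ℕ.^ l
weight q (suc l) e (suc i) = weight q l (q ℕ.* e) i

-- By induction the tail weighs `q` times the head, so the whole weighs q + 1 times the head. The
-- factor `q` passed along in `e` keeps all weights integral.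
sum-weight : ∀ q l e → sum (weight q l e) ≡ q ℕ.* e ℕ.* suc q ℕ.^ l
sum-weight q zero    e = trans (sum-const q e) (sym (ℕₚ.*-identityʳ (q ℕ.* e)))
sum-weight q (suc l) e = trans (cong (q ℕ.* e ℕ.* suc q ℕ.^ l ℕ.+_) (sum-weight q l (q ℕ.* e)))
  (solve 3 (λ q e P → q :* e :* P :+ q :* (q :* e) :* P := q :* e :* ((con 1 :+ q) :* P)) refl q e (suc q ℕ.^ l))
  where open Data.Nat.Solver.+-*-Solver

weight-lower : ∀ q l e i → q ℕ.^ l ℕ.* e ℕ.≤ weight q l e i
weight-lower q zero    e i       = ℕₚ.≤-reflexive (ℕₚ.*-identityˡ e)
weight-lower q (suc l) e zero    = begin
  q ℕ.* q ℕ.^ l ℕ.* e       ≡⟨ solve 3 (λ q Q e → q :* Q :* e := q :* e :* Q) refl q (q ℕ.^ l) e ⟩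
  q ℕ.* e ℕ.* q ℕ.^ l       ≤⟨ ℕₚ.*-monoʳ-≤ (q ℕ.* e) (ℕₚ.^-monoˡ-≤ l (ℕₚ.n≤1+n q)) ⟩
  q ℕ.* e ℕ.* suc q ℕ.^ l   ∎
  where
  open ℕₚ.≤-Reasoning
  open Data.Nat.Solver.+-*-Solver
weight-lower q (suc l) e (suc i) = ℕₚ.≤-trans
  (ℕₚ.≤-reflexive (solve 3 (λ q Q e → q :* Q :* e := Q :* (q :* e)) refl q (q ℕ.^ l) e))
  (weight-lower q l (q ℕ.* e) i)
  where open Data.Nat.Solver.+-*-Solver

*indicator≤ : ∀ m b → m ℕ.* indicator b ℕ.≤ m
*indicator≤ m true  = ℕₚ.≤-reflexive (ℕₚ.*-identityʳ m)
*indicator≤ m false = ℕₚ.≤-trans (ℕₚ.≤-reflexive (ℕₚ.*-zeroʳ m)) z≤n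

-- The witness is the first unchosen index, which is among the first `l` because fewer than `l` are
-- chosen. Everything before it is covered, and it carries 1/(q + 1) of the weight from it onwards.
weight-gap : ∀ q l e (P : Fin (l ℕ.+ q) → Bool) → sum (indicator ∘ P) ℕ.< l →
  ∃ λ i → P i ≡ false × sum (λ i → weight q l e i ℕ.* indicator (not (P i))) ℕ.≤ suc q ℕ.* weight q l e i
weight-gap q (suc l) e P chosen<l with P zero in eq
... | false = zero , eq , (begin
  q ℕ.* e ℕ.* suc q ℕ.^ l ℕ.* 1 ℕ.+ sum (λ i → weight q l (q ℕ.* e) i ℕ.* indicator (not (P (suc i))))
    ≤⟨ ℕₚ.+-mono-≤ (ℕₚ.≤-reflexive (ℕₚ.*-identityʳ _))
         (sum-mono-≤ _ _ (λ i → *indicator≤ (weight q l (q ℕ.* e) i) (not (P (suc i))))) ⟩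
  sum (weight q (suc l) e)
    ≡⟨ sum-weight q (suc l) e ⟩
  q ℕ.* e ℕ.* (suc q ℕ.* suc q ℕ.^ l)
    ≡⟨ solve 3 (λ q e P → q :* e :* ((con 1 :+ q) :* P) := (con 1 :+ q) :* (q :* e :* P)) refl q e (suc q ℕ.^ l) ⟩
  suc q ℕ.* (q ℕ.* e ℕ.* suc q ℕ.^ l) ∎)
  where
  open ℕₚ.≤-Reasoning
  open Data.Nat.Solver.+-*-Solver
... | true with i , open-i , gap ← weight-gap q l (q ℕ.* e) (P ∘ suc) (ℕₚ.≤-pred chosen<l) =
  suc i , open-i , subst (λ z → z ℕ.+ sum (λ i → weight q l (q ℕ.* e) i ℕ.* indicator (not (P (suc i)))) ℕ.≤ suc q ℕ.* weight q l (q ℕ.* e) i)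
    (sym (ℕₚ.*-zeroʳ (q ℕ.* e ℕ.* suc q ℕ.^ l))) gap

-- At least `q` indices stay unchosen, each of weight at least that of the last ones. The `q` equal
-- weights at the end make the bound exact when precisely the first `l` are chosen.
weight-remainder : ∀ q l e (P : Fin (l ℕ.+ q) → Bool) → sum (indicator ∘ P) ℕ.≤ l →
  q ℕ.^ l ℕ.* e ℕ.* q ℕ.≤ sum (λ i → weight q l e i ℕ.* indicator (not (P i)))
weight-remainder q l e P chosen≤l = begin
  c ℕ.* q                                                ≤⟨ ℕₚ.*-monoʳ-≤ c q≤open ⟩
  c ℕ.* sum (indicator ∘ not ∘ P)                        ≡⟨ *-distribˡ-sum c (indicator ∘ not ∘ P) ⟩
  sum (λ i → c ℕ.* indicator (not (P i)))                ≤⟨ sum-mono-≤ _ _ (λ i → ℕₚ.*-monoˡ-≤ (indicator (not (P i))) (weight-lower q l e i)) ⟩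
  sum (λ i → weight q l e i ℕ.* indicator (not (P i)))   ∎
  where
  open ℕₚ.≤-Reasoning
  c = q ℕ.^ l ℕ.* e
  q≤open : q ℕ.≤ sum (indicator ∘ not ∘ P)
  q≤open = ℕₚ.+-cancelʳ-≤ l q _ (ℕₚ.≤-trans (ℕₚ.≤-reflexive (trans (ℕₚ.+-comm q l) (sym (sum-indicator-not P))))
    (ℕₚ.+-monoʳ-≤ (sum (indicator ∘ not ∘ P)) chosen≤l))

-- t is the number of ordered pairs between X and Y.  The first k of the S's leave k s of them uncovered,
-- and k nodes among which at most three are O's leave at least (2 + q) s uncovered.
record HardInstance (q k : ℕ) : Set where
  field
    n         : ℕ
    G         : Graph n
    connected : Connected G
    H         : Subset n
    output    : GreedyOutput G k H
    Copt      : Subset n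
    feasible  : ∣ Copt ∣ ℕ.≤ k
    maximal   : ∀ C → ∣ C ∣ ℕ.≤ k → GBC G C ≤ GBC G Copt
    t s       : ℕ
    1≤t       : 1 ℕ.≤ t
    t-value   : t ℕ.* q ℕ.^ k ≡ suc q ℕ.^ k ℕ.* (k ℕ.* s)
    ps≤t      : suc q ℕ.* s ℕ.≤ t
    upper     : GBC G H + ι ((2 ℕ.+ q) ℕ.* s) ≤ ι (t ℕ.+ s)
    lower     : ι t ≤ GBC G Copt

-- Both clouds scale with `M`: there are at most MQ nodes, so the noise is at most MQZ, while the
-- margin of a comparison is at least M^2. Hence the choice M = QZ + 1.
hardInstance : ∀ q → 1 ℕ.≤ q → ∀ k → k ≡ 5 ℕ.+ q → HardInstance q k
hardInstance q 1≤q k k≡ = record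
  { n = N ; G = gadget
  ; connected = gadget-connected (fromℕ< 1≤K) (fromℕ< 1≤k)
  ; H = proj₁ greedy-output ; output = proj₁ (proj₂ greedy-output)
  ; Copt = proj₁ optimum ; feasible = proj₁ (proj₂ optimum) ; maximal = proj₁ (proj₂ (proj₂ optimum))
  ; t = t ; s = s ; 1≤t = 1≤t ; t-value = t-value ; ps≤t = ps≤t
  ; upper = ≤-trans (≤-reflexive (cong (λ z → GBC gadget (proj₁ greedy-output) + ι z) s-scaled))
      (≤-trans (proj₂ (proj₂ greedy-output)) (ι-mono-≤ (ℕₚ.+-mono-≤ (ℕₚ.≤-reflexive (sym t≡)) 2noise≤s)))
  ; lower = subst (λ z → ι z ≤ GBC gadget (proj₁ optimum)) (sym t≡) (proj₂ (proj₂ (proj₂ optimum)))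
  }
  where
  open Data.Nat.Solver.+-*-Solver
  open ℕₚ.≤-Reasoning
  p K Z Q M : ℕ
  p = suc q
  K = k ℕ.+ q
  Z = K ℕ.+ k ℕ.+ k
  Q = K ℕ.+ k ℕ.+ q ℕ.* p ℕ.^ k ℕ.+ k
  M = suc (Q ℕ.* Z)
  a : Fin K → ℕ
  a = weight q k M
  b : ℕ
  b = M
  t s : ℕ
  t = 2 ℕ.* (q ℕ.* M ℕ.* p ℕ.^ k ℕ.* (k ℕ.* M))
  -- The amount missed, in both directions, per open O when S-weight `q ℕ.^ k ℕ.* M ℕ.* q` is left
  -- open.
  s = 2 ℕ.* (q ℕ.^ k ℕ.* M ℕ.* q ℕ.* M)
  t≡ : t ≡ 2 ℕ.* (sum a ℕ.* sum {k} (λ _ → b))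
  t≡ = cong₂ (λ y z → 2 ℕ.* (y ℕ.* z)) (sym (sum-weight q k M)) (sym (sum-const k M))
  5≤k : 5 ℕ.≤ k
  5≤k = subst (5 ℕ.≤_) (sym k≡) (ℕₚ.m≤m+n 5 q)
  1≤k : 1 ℕ.≤ k
  1≤k = ℕₚ.≤-trans (s≤s z≤n) 5≤k
  1≤K : 1 ℕ.≤ K
  1≤K = ℕₚ.≤-trans 1≤k (ℕₚ.m≤m+n k q)
  4≤nodes : 4 ℕ.≤ nodeCount k a b
  4≤nodes = ℕₚ.≤-trans (ℕₚ.≤-trans (ℕₚ.n≤1+n 4) 5≤k) (ℕₚ.≤-trans (ℕₚ.m≤m+n k q) (ℕₚ.m≤m+n K _))
  1≤q^k : 1 ℕ.≤ q ℕ.^ k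
  1≤q^k = subst (ℕ._≤ q ℕ.^ k) (ℕₚ.^-zeroˡ k) (ℕₚ.^-monoˡ-≤ k 1≤q)
  nodes≤ : nodeCount k a b ℕ.≤ M ℕ.* Q
  nodes≤ = begin
    K ℕ.+ (k ℕ.+ (sum a ℕ.+ sum {k} (λ _ → b)))
      ≡⟨ cong₂ (λ y z → K ℕ.+ (k ℕ.+ (y ℕ.+ z))) (sum-weight q k M) (sum-const k M) ⟩
    K ℕ.+ (k ℕ.+ (q ℕ.* M ℕ.* p ℕ.^ k ℕ.+ k ℕ.* M))
      ≤⟨ ℕₚ.+-mono-≤ (ℕₚ.m≤n*m K M) (ℕₚ.+-monoˡ-≤ _ (ℕₚ.m≤n*m k M)) ⟩
    M ℕ.* K ℕ.+ (M ℕ.* k ℕ.+ (q ℕ.* M ℕ.* p ℕ.^ k ℕ.+ k ℕ.* M))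
      ≡⟨ solve 5 (λ M K k q P → M :* K :+ (M :* k :+ (q :* M :* P :+ k :* M)) := M :* (K :+ k :+ q :* P :+ k)) refl M K k q (p ℕ.^ k) ⟩
    M ℕ.* Q ∎
  noise<MM : noiseBound k a b ℕ.< M ℕ.* M
  noise<MM = begin-strict
    noiseBound k a b ≤⟨ ℕₚ.*-monoˡ-≤ Z nodes≤ ⟩
    M ℕ.* Q ℕ.* Z    ≡⟨ ℕₚ.*-assoc M Q Z ⟩
    M ℕ.* (Q ℕ.* Z)  <⟨ ℕₚ.*-monoʳ-< M (ℕₚ.n<1+n (Q ℕ.* Z)) ⟩
    M ℕ.* M          ∎
  noise<ba : ∀ i → noiseBound k a b ℕ.< b ℕ.* a i
  noise<ba i = ℕₚ.<-≤-trans noise<MM (ℕₚ.*-monoʳ-≤ M (ℕₚ.≤-trans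
    (ℕₚ.≤-trans (ℕₚ.≤-reflexive (sym (ℕₚ.*-identityˡ M))) (ℕₚ.*-monoˡ-≤ M 1≤q^k)) (weight-lower q k M i)))
  -- The gap factor q + 1 of the weights is `p`, which is why k = q + 5 has the required form 4 + p.
  open GreedyOnGadget k p (trans k≡ (sym (ℕₚ.+-suc 4 q))) a b 4≤nodes noise<ba (weight-gap q k M)
    (q ℕ.^ k ℕ.* M ℕ.* q) (weight-remainder q k M)
  2noise≤s : 2 ℕ.* noise ℕ.≤ s
  2noise≤s = ℕₚ.*-monoʳ-≤ 2 (ℕₚ.≤-trans (ℕₚ.<⇒≤ noise<MM) (ℕₚ.*-monoˡ-≤ M (begin
    M                     ≡⟨ solve 1 (λ M → M := con 1 :* M :* con 1) refl M ⟩
    1 ℕ.* M ℕ.* 1         ≤⟨ ℕₚ.*-mono-≤ (ℕₚ.*-monoˡ-≤ M 1≤q^k) 1≤q ⟩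
    q ℕ.^ k ℕ.* M ℕ.* q   ∎)))
  s-scaled : (2 ℕ.+ q) ℕ.* s ≡ 2 ℕ.* (q ℕ.^ k ℕ.* M ℕ.* q ℕ.* (b ℕ.* suc p))
  s-scaled = solve 3 (λ q R M → (con 2 :+ q) :* (con 2 :* (R :* M)) := con 2 :* (R :* (M :* (con 2 :+ q)))) refl q (q ℕ.^ k ℕ.* M ℕ.* q) M
  t-value : t ℕ.* q ℕ.^ k ≡ p ℕ.^ k ℕ.* (k ℕ.* s)
  t-value = solve 5 (λ q M P k R → con 2 :* (q :* M :* P :* (k :* M)) :* R := P :* (k :* (con 2 :* (R :* M :* q :* M)))) refl q M (p ℕ.^ k) k (q ℕ.^ k)
  p≤k : p ℕ.≤ k
  p≤k = subst (p ℕ.≤_) (sym k≡) (s≤s (ℕₚ.m≤n+m q 4))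
  ps≤t : p ℕ.* s ℕ.≤ t
  ps≤t = begin
    p ℕ.* s
      ≤⟨ ℕₚ.*-mono-≤ p≤k (ℕₚ.*-monoʳ-≤ 2 (ℕₚ.*-monoˡ-≤ M (ℕₚ.*-monoˡ-≤ q (ℕₚ.*-monoˡ-≤ M (ℕₚ.^-monoˡ-≤ k (ℕₚ.n≤1+n q)))))) ⟩
    k ℕ.* (2 ℕ.* (p ℕ.^ k ℕ.* M ℕ.* q ℕ.* M))
      ≡⟨ solve 4 (λ k P M q → k :* (con 2 :* (P :* M :* q :* M)) := con 2 :* (q :* M :* P :* (k :* M))) refl k (p ℕ.^ k) M q ⟩
    t ∎
  1≤t : 1 ℕ.≤ t
  1≤t = ℕₚ.*-mono-≤ {1} {2} (s≤s z≤n) (ℕₚ.*-mono-≤ (ℕₚ.*-mono-≤ (ℕₚ.*-mono-≤ 1≤q (s≤s {n = Q ℕ.* Z} z≤n))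
    (ℕₚ.≤-trans 1≤q^k (ℕₚ.^-monoˡ-≤ k (ℕₚ.n≤1+n q)))) (ℕₚ.*-mono-≤ 1≤k (s≤s {n = Q ℕ.* Z} z≤n)))

-- The approximation ratio.

ratio-bound : ∀ {g o T x y ε t s c} → g + c ≤ t + s → t ≤ o → T + ((1ℚ + 1ℚ) + (1ℚ + 1ℚ)) * x ≤ y + ε →
  y * t ≡ c + (s + s + s) → s ≤ x * t → y ≤ 1ℚ → 0ℚ ≤ x → 0ℚ ≤ t → g ≤ (1ℚ - T + ε) * o
ratio-bound {g} {o} {T} {x} {y} {ε} {t} {s} {c} g+c≤t+s t≤o T+4x≤y+ε yt≡ s≤xt y≤1 0≤x 0≤t = begin
  g                             ≤⟨ ≤-from-slack ((t + s - (g + c)) + four * (x * t - s))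
                                     (0≤+ (slack g+c≤t+s) (0≤* 0≤four (slack s≤xt))) eq ⟩
  ρ * t                         ≤⟨ *-monoˡ-≤-nonNeg ρ {{nonNegative 0≤ρ}} t≤o ⟩
  ρ * o                         ≤⟨ *-monoʳ-≤-nonNeg o {{nonNegative (≤-trans 0≤t t≤o)}}
                                     (≤-from-slack {ρ} {1ℚ - T + ε} ((y + ε) - (T + four * x)) (slack T+4x≤y+ε) (solve 4 (λ T x y ε →
                                        con 1ℚ :- T :+ ε := (con 1ℚ :- y :+ con four :* x) :+ ((y :+ ε) :- (T :+ con four :* x)))
                                        refl T x y ε)) ⟩
  (1ℚ - T + ε) * o              ∎
  where
  open ≤-Reasoning
  open +-*-Solver
  four ρ : ℚ
  four = (1ℚ + 1ℚ) + (1ℚ + 1ℚ)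
  -- Eliminating `c` gives g ≤ t - yt + 4s: three copies of `s` separate `c` from yt, and the fourth
  -- is the noise. Then s ≤ xt turns the bound into ρt, and 0 ≤ ρ allows `t` to be replaced by `o`.
  ρ = 1ℚ - y + four * x
  0≤four : 0ℚ ≤ four
  0≤four = 0≤+ (0≤+ 0≤1 0≤1) (0≤+ 0≤1 0≤1)
  0≤ρ : 0ℚ ≤ ρ
  0≤ρ = 0≤+ (slack y≤1) (0≤* 0≤four 0≤x)
  eq : ρ * t ≡ g + ((t + s - (g + c)) + four * (x * t - s))
  eq = trans (solve 3 (λ x y t → (con 1ℚ :- y :+ con four :* x) :* t := t :- y :* t :+ con four :* (x :* t)) refl x y t)
    (trans (cong (λ z → t - z + four * (x * t)) yt≡)
      (solve 5 (λ g c t s X → t :- (c :+ (s :+ s :+ s)) :+ con four :* X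
        := g :+ ((t :+ s :- (g :+ c)) :+ con four :* (X :- s))) refl g c t s (x * t)))

hardInstance-ratio : ∀ {q k} (I : HardInstance q k) → k ≡ 5 ℕ.+ q → ∀ {T x y ε} →
  ι (suc q) * x ≡ 1ℚ → ι (suc q ℕ.^ k) * y ≡ ι (q ℕ.^ k) → T + ι 4 * x ≤ y + ε →
  let open HardInstance I in GBC G H ≤ (1ℚ - T + ε) * GBC G Copt
hardInstance-ratio {q} {k} I k≡ {T} {x} {y} {ε} px≡1 y-value bound = ratio-bound {T = T} {x} {y} {ε} {c = ι ((2 ℕ.+ q) ℕ.* s)}
  (subst (GBC G H + ι ((2 ℕ.+ q) ℕ.* s) ≤_) (ι-+ t s) upper) lower
  (subst (λ z → T + z * x ≤ y + ε) four≡ bound) yt≡ s≤xt y≤1 0≤x (0≤ι t)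
  where
  open HardInstance I
  p^k-1 = ℕ.pred (suc q ℕ.^ k)
  four≡ : ι 4 ≡ (1ℚ + 1ℚ) + (1ℚ + 1ℚ)
  four≡ = trans (ι-+ 2 2) (cong₂ _+_ two≡ two≡)
    where
    two≡ : ι 2 ≡ 1ℚ + 1ℚ
    two≡ = trans (ι-+ 1 1) (cong₂ _+_ ι-1 ι-1)
  suc-p^k-1 : suc p^k-1 ≡ suc q ℕ.^ k
  suc-p^k-1 = ℕₚ.suc-pred (suc q ℕ.^ k) {{ℕₚ.m^n≢0 (suc q) k}}
  cancel-p^k : ∀ {u v} → ι (suc q ℕ.^ k) * u ≤ ι (suc q ℕ.^ k) * v → u ≤ v
  cancel-p^k {u} {v} h = *ι-cancel-≤ p^k-1 (subst (λ z → ι z * u ≤ ι z * v) (sym suc-p^k-1) h)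
  y≤1 : y ≤ 1ℚ
  y≤1 = cancel-p^k (subst₂ _≤_ (sym y-value) (sym (*-identityʳ (ι (suc q ℕ.^ k)))) (ι-mono-≤ (ℕₚ.^-monoˡ-≤ k (ℕₚ.n≤1+n q))))
  0≤x : 0ℚ ≤ x
  0≤x = *ι-cancel-≤ q (subst₂ _≤_ (sym (*-zeroʳ (ι (suc q)))) (sym px≡1) 0≤1)
  s≤xt : ι s ≤ x * ι t
  s≤xt = begin
    ι s                      ≡⟨ sym (*-identityˡ (ι s)) ⟩
    1ℚ * ι s                 ≡⟨ cong (_* ι s) (trans (sym px≡1) (*-comm (ι (suc q)) x)) ⟩
    x * ι (suc q) * ι s      ≡⟨ *-assoc x (ι (suc q)) (ι s) ⟩
    x * (ι (suc q) * ι s)    ≡⟨ cong (x *_) (sym (ι-* (suc q) s)) ⟩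
    x * ι (suc q ℕ.* s)      ≤⟨ *-monoˡ-≤-nonNeg x {{nonNegative 0≤x}} (ι-mono-≤ ps≤t) ⟩
    x * ι t                  ∎
    where open ≤-Reasoning
  yt≡ks : y * ι t ≡ ι (k ℕ.* s)
  -- The positive factor is cancelled from an inequality, so the equation is treated as two of them.
  yt≡ks = ≤-antisym (cancel-p^k (≤-reflexive scaled)) (cancel-p^k (≤-reflexive (sym scaled)))
    where
    open ≡-Reasoning
    scaled : ι (suc q ℕ.^ k) * (y * ι t) ≡ ι (suc q ℕ.^ k) * ι (k ℕ.* s)
    scaled = begin
      ι (suc q ℕ.^ k) * (y * ι t)        ≡⟨ sym (*-assoc (ι (suc q ℕ.^ k)) y (ι t)) ⟩
      ι (suc q ℕ.^ k) * y * ι t          ≡⟨ cong (_* ι t) y-value ⟩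
      ι (q ℕ.^ k) * ι t                  ≡⟨ *-comm (ι (q ℕ.^ k)) (ι t) ⟩
      ι t * ι (q ℕ.^ k)                  ≡⟨ sym (ι-* t (q ℕ.^ k)) ⟩
      ι (t ℕ.* q ℕ.^ k)                  ≡⟨ cong ι t-value ⟩
      ι (suc q ℕ.^ k ℕ.* (k ℕ.* s))      ≡⟨ ι-* (suc q ℕ.^ k) (k ℕ.* s) ⟩
      ι (suc q ℕ.^ k) * ι (k ℕ.* s)      ∎
  yt≡ : y * ι t ≡ ι ((2 ℕ.+ q) ℕ.* s) + (ι s + ι s + ι s)
  yt≡ = trans yt≡ks (trans (cong ι ks≡) (trans (ι-+ ((2 ℕ.+ q) ℕ.* s) (s ℕ.+ s ℕ.+ s))
    (cong (λ z → ι ((2 ℕ.+ q) ℕ.* s) + z) (trans (ι-+ (s ℕ.+ s) s) (cong (_+ ι s) (ι-+ s s))))))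
    where
    open Data.Nat.Solver.+-*-Solver
    -- k = (q + 2) + 3: the output leaves at least q + 2 of the O's open, and the other three are
    -- those that a seed may contain.
    ks≡ : k ℕ.* s ≡ (2 ℕ.+ q) ℕ.* s ℕ.+ (s ℕ.+ s ℕ.+ s)
    ks≡ = trans (cong (ℕ._* s) k≡) (solve 2 (λ q s → (con 5 :+ q) :* s := (con 2 :+ q) :* s :+ (s :+ s :+ s)) refl q s)

theorem2 : (ε : ℚ) → 0ℚ < ε →
    ∃ λ (n : ℕ) → Σ (Graph n) λ G → Connected G ×
    ∃ λ (k : ℕ) → 1 ≤ℕ k ×
    ∃ λ (H : Subset n) → GreedyOutput G k H ×
    ∃ λ (Copt : Subset n) → ∣ Copt ∣ ≤ℕ k ×
    (∀ (C : Subset n) → ∣ C ∣ ≤ℕ k → GBC G C ≤ GBC G Copt) ×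
    0ℚ < GBC G Copt ×
    ∃ λ (m : ℕ) → GBC G H ≤ (1ℚ - invEUpper m + ε) * GBC G Copt
theorem2 ε 0<ε = conclude (e-approximation ε 0<ε)
  where
  fromInstance : ∀ {q k m x y} → k ≡ 5 ℕ.+ q → HardInstance q k → ι (suc q) * x ≡ 1ℚ →
    ι (suc q ℕ.^ k) * y ≡ ι (q ℕ.^ k) → invEUpper m + ι 4 * x ≤ y + ε →
    ∃ λ n → Σ (Graph n) λ G → Connected G × ∃ λ k → 1 ≤ℕ k × ∃ λ H → GreedyOutput G k H ×
    ∃ λ Copt → ∣ Copt ∣ ≤ℕ k × (∀ C → ∣ C ∣ ≤ℕ k → GBC G C ≤ GBC G Copt) ×
    0ℚ < GBC G Copt × ∃ λ m → GBC G H ≤ (1ℚ - invEUpper m + ε) * GBC G Copt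
  fromInstance {q} {k} {m} k≡ I px≡1 y-value bound =
    n , G , connected , k , subst (1 ≤ℕ_) (sym k≡) (s≤s z≤n) , H , output , Copt , feasible , maximal ,
    <-≤-trans (subst (_< ι t) ι-0 (ι-mono-< 1≤t)) lower , m , hardInstance-ratio I k≡ {invEUpper m} {ε = ε} px≡1 y-value bound
    where open HardInstance I

  conclude : EApproximation ε → _
  conclude (q , 1≤q , m , x , y , px≡1 , y-value , bound) =
    fromInstance {m = m} refl (hardInstance q 1≤q (5 ℕ.+ q) refl) px≡1 y-value bound
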